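{- There is an absolute constant $C>0$ such that for every odd prime $p$ there exists a transversal of $B_p$, different from the main diagonal $\{(i,i,2i): i\in\mathbb{Z}_p\}$, containing at most $C\log p$ triples $(r,c,s)$ with $r\neq c$.
   Context: $B_p$ is the Latin square of order $p$ viewed as the set of triples $\{(i,j,i+j \bmod p): i,j\in\mathbb{Z}_p\}$ (row, column, symbol). A transversal of a Latin square of order $p$ is a set of $p$ of its triples that contains each row, each column and each symbol exactly once. The main diagonal consists of the cells $(i,i)$. -}

module Defs where

open import Data.Fin.Base using (Fin; toℕ)
open import Data.Fin.Properties using (_≟_; nonZeroIndex)
open import Data.List.Base using (List; allFin; filter; length; map)
open import Data.List.Membership.Propositional using (_∈_)
open import Data.List.Relation.Unary.All using (All)
open import Data.List.Relation.Unary.Unique.Propositional using (Unique)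
open import Data.Nat.Base using (ℕ; _+_)
open import Data.Nat.DivMod using (_mod_)
open import Data.Product using (_×_; _,_; ∃!)
open import Level using (0ℓ)
open import Relation.Binary.PropositionalEquality using (_≡_)
open import Relation.Nullary.Decidable using (¬?)
open import Relation.Unary using (Pred)

-- Addition in ℤ_p; an element i : Fin p already witnesses that p is nonzero.
infixl 6 _⊕_
_⊕_ : ∀ {p} → Fin p → Fin p → Fin p
_⊕_ {p} i j = _mod_ (toℕ i + toℕ j) p {{nonZeroIndex i}}

Triple : ℕ → Set
Triple p = Fin p × Fin p × Fin p

row col sym : ∀ {p} → Triple p → Fin p
row (r , _ , _) = r
col (_ , c , _) = c
sym (_ , _ , s) = s

B : ∀ p → Pred (Triple p) 0ℓ
B p (r , c , s) = s ≡ r ⊕ c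

-- A finite set of triples is given by a list without repetitions, so that its
-- cardinality is the length of the list.
record IsTransversal {p : ℕ} (L : Pred (Triple p) 0ℓ) (T : List (Triple p)) : Set where
  field
    unique  : Unique T
    size    : length T ≡ p
    subset  : All L T
    rows    : ∀ r → ∃! _≡_ λ t → t ∈ T × row t ≡ r
    columns : ∀ c → ∃! _≡_ λ t → t ∈ T × col t ≡ c
    symbols : ∀ s → ∃! _≡_ λ t → t ∈ T × sym t ≡ s

mainDiagonal : ∀ p → List (Triple p)
mainDiagonal p = map (λ i → i , i , i ⊕ i) (allFin p)

offDiagonal : ∀ {p} → List (Triple p) → List (Triple p)
offDiagonal = filter λ t → ¬? (row t ≟ col t)

{-# OPTIONS --safe #-}

-- If l and r permute a set S ⊂ ℤ_p and l(m) + r(m) = 2m for all m ∈ S, then the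
-- triples (l(m), r(m), 2m) for m ∈ S and (i, i, 2i) for i ∉ S form a transversal.
-- Such an S is a directed graph with two edges into and two edges out of every
-- vertex, whose vertices are distinct elements of ℤ_p, each of them the midpoint
-- of its two successors.  One obtains it from a graph (a web) of natural numbers
-- with four loose edges, two coming in at A and at B and two going out to A + B
-- and to 0: modulo B, each incoming edge meets an outgoing one.  Size and parity
-- keep the vertices distinct modulo B.
--
-- Gadgets of at most four vertices turn a web for (A , B) into larger ones.  The
-- ratio x = (A − B) / (A + B) becomes (±x ± 1) / 4, (±x ± 1) / 8 or x / 4.  The
-- images of the interval |x| ≤ 1/3 cover it, so by descent every pair of odd numbers
-- with A + B = 2^(k+1) and |x| ≤ 1/3 has a web with O(k) vertices.  An odd p is the
-- side B of such a pair.

module Submission where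

open import Defs hiding (sym)
import Defs
open import Data.Empty using (⊥; ⊥-elim)
open import Data.Fin.Base using (Fin; toℕ; punchOut) renaming (zero to 0F; suc to sucF)
open import Data.Fin.Properties using (any?; injective⇒≤; punchOut-injective; toℕ-fromℕ<; toℕ-injective; toℕ<n) renaming (_≟_ to _≟F_)
open import Data.List.Base using (List; []; _∷_; _++_; length; map; allFin; lookup)
import Data.List.Membership.DecPropositional as DecMembership
open import Data.List.Membership.Propositional using (_∈_; _∉_)
open import Data.List.Membership.Propositional.Properties using (∈-map⁺; ∈-map⁻; ∈-allFin; ∈-filter⁻; ∈-lookup; ∈-++⁺ˡ; ∈-++⁺ʳ)
open import Data.List.Properties using (length-map; length-tabulate; length-++; map-∘; map-++)
open import Data.List.Relation.Binary.BagAndSetEquality using (_∼[_]_; set)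
open import Data.List.Relation.Unary.All as All using (All)
import Data.List.Relation.Unary.All.Properties as All
import Data.List.Relation.Unary.AllPairs as AllPairs
open import Data.List.Relation.Unary.Any using (here; there; index)
open import Data.List.Relation.Unary.Any.Properties using (lookup-index)
open import Data.List.Relation.Unary.Unique.Propositional using (Unique)
open import Data.List.Relation.Unary.Unique.Propositional.Properties as Unique using (Unique[x∷xs]⇒x∉xs)
open import Data.Nat.Base
open import Data.Nat.DivMod
open import Data.Nat.Divisibility
open import Data.Nat.Induction using (<-rec)
open import Data.Nat.Logarithm using (⌊log₂_⌋; ⌊log₂⌋-mono-≤; ⌊log₂[2*b]⌋≡1+⌊log₂b⌋; ⌊log₂[2^n]⌋≡n)
open import Data.Nat.Primality using (Prime; prime⇒nonZero; prime⇒nonTrivial)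
open import Data.Nat.Properties
open import Data.Nat.Tactic.RingSolver using (solve)
open import Data.Product using (Σ-syntax; ∃-syntax; ∃₂; ∃!; _×_; _,_; proj₁; proj₂)
open import Data.Sum.Base using (_⊎_; inj₁; inj₂; [_,_]′)
open import Function.Base using (_∘_; id)
open import Function.Bundles using (Equivalence)
open import Relation.Binary.Definitions using (tri<; tri≈; tri>)
open import Relation.Binary.PropositionalEquality
open import Relation.Nullary using (¬_; yes; no; contradiction)
open import Relation.Nullary.Decidable using (¬?)

-- Cells, and pigeonhole facts for finite sets and lists.

record Cell (A : Set) : Set where
  constructor cell
  field
    left mid right : A
open Cell

lefts mids rights : {A : Set} → List (Cell A) → List A
lefts  = map left
mids   = map mid
rights = map right

mapCell : {A B : Set} → (A → B) → Cell A → Cell B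
mapCell f (cell l m r) = cell (f l) (f m) (f r)

swap : {A : Set} → Cell A → Cell A
swap (cell l m r) = cell r m l

-- A section of `f` is injective. If it missed a point, `punchOut` would inject `Fin (suc n)` into
-- `Fin n`; so it is a two-sided inverse of `f`.
surjective⇒injective : ∀ {n} (f : Fin n → Fin n) → (∀ y → ∃[ x ] f x ≡ y) →
                       ∀ {i j} → f i ≡ f j → i ≡ j
surjective⇒injective {suc n} f surj {i} {j} fi≡fj =
  trans (sym (section∘f i)) (trans (cong section fi≡fj) (section∘f j))
  where
  section : Fin (suc n) → Fin (suc n)
  section y = proj₁ (surj y)

  f∘section : ∀ y → f (section y) ≡ y
  f∘section y = proj₂ (surj y)

  section-injective : ∀ {x y} → section x ≡ section y → x ≡ y
  section-injective eq = trans (sym (f∘section _)) (trans (cong f eq) (f∘section _))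

  section-surjective : ∀ x → ∃[ y ] x ≡ section y
  section-surjective x with any? (λ y → x ≟F section y)
  ... | yes hit  = hit
  ... | no  miss = contradiction
    (injective⇒≤ {f = λ y → punchOut (miss ∘ (y ,_))}
      λ {y} {y′} → section-injective ∘ punchOut-injective (miss ∘ (y ,_)) (miss ∘ (y′ ,_)))
    1+n≰n

  section∘f : ∀ x → section (f x) ≡ x
  section∘f x with y , refl ← section-surjective x = cong section (f∘section y)

module _ {A : Set} where

  lookup-injective : ∀ {xs : List A} → Unique xs → ∀ {i j} → lookup xs i ≡ lookup xs j → i ≡ j
  lookup-injective {_ ∷ _}  u       {0F}     {0F}     _  = refl
  lookup-injective {_ ∷ xs} u       {0F}     {sucF j} eq = contradiction (subst (_∈ xs) (sym eq) (∈-lookup j)) (Unique[x∷xs]⇒x∉xs u)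
  lookup-injective {_ ∷ xs} u       {sucF i} {0F}     eq = contradiction (subst (_∈ xs) eq (∈-lookup i)) (Unique[x∷xs]⇒x∉xs u)
  lookup-injective {_ ∷ _}  (_ AllPairs.∷ u) {sucF i} {sucF j} eq = cong sucF (lookup-injective u eq)

  length-unique-≤ : ∀ {xs ys : List A} → Unique xs → (∀ {x} → x ∈ xs → x ∈ ys) → length xs ≤ length ys
  length-unique-≤ {xs} {ys} u xs⊆ys = injective⇒≤ {f = f} λ {i} {j} eq → lookup-injective u
    (trans (at i) (trans (cong (lookup ys) eq) (sym (at j))))
    where
    f : Fin (length xs) → Fin (length ys)
    f i = index (xs⊆ys (∈-lookup i))
    at : ∀ i → lookup xs i ≡ lookup ys (f i)
    at i = lookup-index (xs⊆ys (∈-lookup i))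

-- From configurations in ℤ_p to transversals.

module _ {p : ℕ} where
  open DecMembership (_≟F_ {p}) using (_∈?_)

  perturb : (Cell (Fin p) → Fin p) → List (Cell (Fin p)) → Fin p → Fin p
  perturb h []       x = x
  perturb h (c ∷ cs) x with x ≟F mid c
  ... | yes _ = h c
  ... | no  _ = perturb h cs x

  perturb-outside : ∀ h cs {x} → x ∉ mids cs → perturb h cs x ≡ x
  perturb-outside h []       x∉ = refl
  perturb-outside h (c ∷ cs) {x} x∉ with x ≟F mid c
  ... | yes x≡ = contradiction (here x≡) x∉
  ... | no  _  = perturb-outside h cs (x∉ ∘ there)

  perturb-mid : ∀ h cs {c} → Unique (mids cs) → c ∈ cs → perturb h cs (mid c) ≡ h c
  perturb-mid h (c ∷ cs) {d} u d∈ with mid d ≟F mid c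
  perturb-mid h (c ∷ cs) u       (here refl) | yes _ = refl
  perturb-mid h (c ∷ cs) u       (there d∈)  | yes d≡c = contradiction (subst (_∈ mids cs) d≡c (∈-map⁺ mid d∈)) (Unique[x∷xs]⇒x∉xs u)
  perturb-mid h (c ∷ cs) u       (here refl) | no d≢c = contradiction refl d≢c
  perturb-mid h (c ∷ cs) (_ AllPairs.∷ u) (there d∈)  | no _ = perturb-mid h cs u d∈

  -- A point that is not a vertex is its own preimage; a vertex is some `h c`, attained at `mid c`.
  perturb-surjective : ∀ h cs → Unique (mids cs) → All (_∈ map h cs) (mids cs) →
                       ∀ y → ∃[ x ] perturb h cs x ≡ y
  perturb-surjective h cs u ⊆h y with y ∈? mids cs
  ... | no y∉ = y , perturb-outside h cs y∉
  ... | yes y∈ with c , c∈ , y≡ ← ∈-map⁻ h (All.lookup ⊆h y∈) = mid c , trans (perturb-mid h cs u c∈) (sym y≡)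

  -- Each strand is only asked to reach every vertex. That makes the perturbed identity surjective
  -- on `Fin p`, and finiteness then makes it a permutation.
  record Configuration (cs : List (Cell (Fin p))) : Set where
    field
      midpoint : All (λ c → left c ⊕ right c ≡ mid c ⊕ mid c) cs
      unique   : Unique (mids cs)
      inLefts  : All (_∈ lefts cs) (mids cs)
      inRights : All (_∈ rights cs) (mids cs)
      moved    : ∃[ c ] c ∈ cs × left c ≢ right c

  module _ (double-surjective : ∀ (s : Fin p) → ∃[ x ] x ⊕ x ≡ s) {cs : List (Cell (Fin p))} (conf : Configuration cs) where
    open Configuration conf

    L R D : Fin p → Fin p
    L = perturb left cs
    R = perturb right cs
    D x = x ⊕ x

    triple : Fin p → Triple p
    triple x = L x , R x , D x

    transversal : List (Triple p)
    transversal = map triple (allFin p)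

    inside-or-outside : ∀ x → (∃[ c ] c ∈ cs × x ≡ mid c) ⊎ x ∉ mids cs
    inside-or-outside x with x ∈? mids cs
    ... | yes x∈ = inj₁ (∈-map⁻ mid x∈)
    ... | no  x∉ = inj₂ x∉

    L⊕R≡D : ∀ x → L x ⊕ R x ≡ D x
    L⊕R≡D x with inside-or-outside x
    ... | inj₁ (c , c∈ , refl) = trans (cong₂ _⊕_ (perturb-mid left cs unique c∈) (perturb-mid right cs unique c∈)) (All.lookup midpoint c∈)
    ... | inj₂ x∉ = cong₂ _⊕_ (perturb-outside left cs x∉) (perturb-outside right cs x∉)

    L-surjective : ∀ r → ∃[ x ] L x ≡ r
    L-surjective = perturb-surjective left cs unique inLefts

    R-surjective : ∀ c → ∃[ x ] R x ≡ c
    R-surjective = perturb-surjective right cs unique inRights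

    -- Surjectivity of `f` gives existence; on a finite set it also gives injectivity, hence
    -- uniqueness.
    meets-once : ∀ {f : Fin p → Fin p} (coordinate : Triple p → Fin p) → (∀ x → coordinate (triple x) ≡ f x) →
                 (∀ y → ∃[ x ] f x ≡ y) → ∀ y → ∃! _≡_ λ t → t ∈ transversal × coordinate t ≡ y
    meets-once {f} coordinate eq surj y with x , fx≡y ← surj y =
      triple x , (∈-map⁺ triple (∈-allFin x) , trans (eq x) fx≡y) , λ (t∈ , ty) → only t∈ ty
      where
      only : ∀ {t} → t ∈ transversal → coordinate t ≡ y → triple x ≡ t
      only t∈ ty with x′ , _ , refl ← ∈-map⁻ triple t∈ =
        cong triple (surjective⇒injective f surj (trans fx≡y (trans (sym ty) (eq x′))))

    isTransversal : IsTransversal (B p) transversal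
    isTransversal = record
      { unique  = Unique.map⁺ (surjective⇒injective L L-surjective ∘ cong row) (Unique.allFin⁺ p)
      ; size    = trans (length-map triple (allFin p)) (length-tabulate id)
      ; subset  = All.map⁺ (All.tabulate λ {x} _ → sym (L⊕R≡D x))
      ; rows    = meets-once row (λ _ → refl) L-surjective
      ; columns = meets-once col (λ _ → refl) R-surjective
      ; symbols = meets-once sym′ (λ _ → refl) double-surjective
      }
      where
      sym′ : Triple p → Fin p
      sym′ = Defs.sym

    -- The moved cell yields a triple with different row and column, which the diagonal does not
    -- contain.
    notDiagonal : ¬ (transversal ∼[ set ] mainDiagonal p)
    notDiagonal same with c , c∈ , l≢r ← moved
      with i , _ , eq ← ∈-map⁻ (λ i → i , i , i ⊕ i) (Equivalence.to same (∈-map⁺ triple (∈-allFin (mid c)))) =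
      l≢r (trans (sym (perturb-mid left cs unique c∈)) (trans (cong row eq) (trans (sym (cong col eq)) (perturb-mid right cs unique c∈))))

    -- The triple at a point that is not a vertex lies on the diagonal. The remaining ones are
    -- distinct and indexed by cells, so there are no more of them than cells.
    offDiagonal-≤ : length (offDiagonal transversal) ≤ length cs
    offDiagonal-≤ = subst (length (offDiagonal transversal) ≤_) (length-map triple′ cs)
      (length-unique-≤ (Unique.filter⁺ off? (IsTransversal.unique isTransversal)) λ t∈ →
        let t∈T , l≢r = ∈-filter⁻ off? t∈ in perturbed t∈T l≢r)
      where
      off? = λ (t : Triple p) → ¬? (row t ≟F col t)
      triple′ : Cell (Fin p) → Triple p
      triple′ = triple ∘ mid
      perturbed : ∀ {t} → t ∈ transversal → row t ≢ col t → t ∈ map triple′ cs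
      perturbed t∈ l≢r with x , _ , refl ← ∈-map⁻ triple t∈ with inside-or-outside x
      ... | inj₁ (c , c∈ , refl) = ∈-map⁺ triple′ c∈
      ... | inj₂ x∉ = contradiction (trans (perturb-outside left cs x∉) (sym (perturb-outside right cs x∉))) l≢r

-- A tool for linear inequalities; webs of natural numbers and their extensions.

-- Derives a linear inequality from a sum a ≤ b of hypotheses, k being the slack.
≤-by : ∀ {a b x y} k → a ≤ b → k + (x + b) ≡ y + a → x ≤ y
≤-by {a} {b} {x} {y} k a≤b eq = +-cancelʳ-≤ b x y (begin
  x + b       ≤⟨ m≤n+m (x + b) k ⟩
  k + (x + b) ≡⟨ eq ⟩
  y + a       ≤⟨ +-monoʳ-≤ y a≤b ⟩
  y + b       ∎)
  where open ≤-Reasoning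

-- Every vertex has one incoming and one outgoing edge of each of two strands.
-- Here ms are the vertices and hs the heads of the edges starting at them; one
-- edge comes in from outside, with head entry, and one goes out, with head exit.
record Strand (entry exit : ℕ) (ms hs : List ℕ) : Set where
  constructor strand
  field
    covered : All (_∈ entry ∷ hs) ms
    exits   : exit ∈ hs

-- The loose ends of the old strand are absorbed: its outgoing edge, now ending at `f e`, can serve
-- a new vertex, and its entry `f u` is reached by a new edge or becomes the new entry.
extend : ∀ (f : ℕ → ℕ) {u e u′ e′ ms hs ks ns} → Strand u e ms hs →
         All (_∈ f e ∷ u′ ∷ ns) ks → f u ∈ u′ ∷ ns → e′ ∈ ns →
         Strand u′ e′ (ks ++ map f ms) (ns ++ map f hs)
extend f {u} {e} {u′} {hs = hs} {ns = ns} (strand covered e∈hs) ks⊆ fu∈ e′∈ = strand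
  (All.++⁺ (All.map new ks⊆) (All.map⁺ (All.map old covered)))
  (∈-++⁺ˡ e′∈)
  where
  new : ∀ {m} → m ∈ f e ∷ u′ ∷ ns → m ∈ u′ ∷ ns ++ map f hs
  new (here refl) = there (∈-++⁺ʳ ns (∈-map⁺ f e∈hs))
  new (there m∈)  = ∈-++⁺ˡ m∈

  old : ∀ {m} → m ∈ u ∷ hs → f m ∈ u′ ∷ ns ++ map f hs
  old (here refl) = ∈-++⁺ˡ fu∈
  old (there m∈)  = there (∈-++⁺ʳ ns (∈-map⁺ f m∈))

record Ends : Set where
  constructor ends
  field
    entryˡ exitˡ entryʳ exitʳ : ℕ
open Ends

Midpoint : Cell ℕ → Set
Midpoint c = left c + right c ≡ mid c + mid c

-- `P` records where the vertices lie. It keeps new vertices apart from old ones in an extension,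
-- and residues distinct when the web is closed up.
record Web (E : Ends) (P : ℕ → Set) (n : ℕ) : Set where
  field
    cells    : List (Cell ℕ)
    midpoint : All Midpoint cells
    strandˡ  : Strand (entryˡ E) (exitˡ E) (mids cells) (lefts cells)
    strandʳ  : Strand (entryʳ E) (exitʳ E) (mids cells) (rights cells)
    range    : All P (mids cells)
    unique   : Unique (mids cells)
    size     : length cells ≤ n
open Web

map-map : ∀ {A B C D : Set} {g : B → C} {f : A → B} {g′ : D → C} {f′ : A → D} → (∀ x → g (f x) ≡ g′ (f′ x)) →
          ∀ xs → map g (map f xs) ≡ map g′ (map f′ xs)
map-map eq []       = refl
map-map eq (x ∷ xs) = cong₂ _∷_ (eq x) (map-map eq xs)

twist : ∀ {u e u′ e′ P n} → Web (ends u e u′ e′) P n → Web (ends u′ e′ u e) P n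
twist {u} {e} {u′} {e′} {P} {n} W = record
  { cells    = map swap (cells W)
  ; midpoint = All.map⁺ (All.map (λ {c} eq → trans (+-comm (right c) (left c)) eq) (midpoint W))
  ; strandˡ  = subst₂ (Strand u′ e′) (map-∘ (cells W)) (map-∘ (cells W)) (strandʳ W)
  ; strandʳ  = subst₂ (Strand u e) (map-∘ (cells W)) (map-∘ (cells W)) (strandˡ W)
  ; range    = subst (All P) (map-∘ (cells W)) (range W)
  ; unique   = subst Unique (map-∘ (cells W)) (unique W)
  ; size     = subst (_≤ n) (sym (length-map swap (cells W))) (size W)
  }

-- Affine maps preserve midpoints. The factor is written `suc s` so that the map is also injective.
dilate-midpoint : ∀ s t l m r → l + r ≡ m + m → (suc s * l + t) + (suc s * r + t) ≡ (suc s * m + t) + (suc s * m + t)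
dilate-midpoint s t l m r eq = begin
  (suc s * l + t) + (suc s * r + t) ≡⟨ collect l r ⟩
  suc s * (l + r) + (t + t)         ≡⟨ cong (λ x → suc s * x + (t + t)) eq ⟩
  suc s * (m + m) + (t + t)         ≡⟨ collect m m ⟨
  (suc s * m + t) + (suc s * m + t) ∎
  where
  open ≡-Reasoning
  collect : ∀ x y → (suc s * x + t) + (suc s * y + t) ≡ suc s * (x + y) + (t + t)
  collect x y = solve (s ∷ t ∷ x ∷ y ∷ [])

-- What a gadget has to satisfy, stated for its few new cells and the ends. Only `fresh` refers to
-- the old vertices, and it sees them through `P`.
record Extension (E E′ : Ends) (P : ℕ → Set) (s t : ℕ) (new : List (Cell ℕ)) : Set where
  f : ℕ → ℕ
  f v = suc s * v + t
  field
    midpoint⁺ : All Midpoint new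
    coverˡ    : All (_∈ f (exitˡ E) ∷ entryˡ E′ ∷ lefts new) (mids new)
    enterˡ    : f (entryˡ E) ∈ entryˡ E′ ∷ lefts new
    leaveˡ    : exitˡ E′ ∈ lefts new
    coverʳ    : All (_∈ f (exitʳ E) ∷ entryʳ E′ ∷ rights new) (mids new)
    enterʳ    : f (entryʳ E) ∈ entryʳ E′ ∷ rights new
    leaveʳ    : exitʳ E′ ∈ rights new
    unique⁺   : Unique (mids new)
    fresh     : ∀ {v} → P v → All (_≢ f v) (mids new)

module _ {E E′ P s t new} (X : Extension E E′ P s t new) where
  open Extension X

  image : List (Cell ℕ) → List (Cell ℕ)
  image cs = new ++ map (mapCell f) cs

  map-image : ∀ (h : Cell ℕ → ℕ) → (∀ c → h (mapCell f c) ≡ f (h c)) → ∀ cs → map h new ++ map f (map h cs) ≡ map h (image cs)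
  map-image h eq cs = trans (cong (map h new ++_) (map-map (sym ∘ eq) cs)) (sym (map-++ h new _))

  extendWeb : ∀ {P′ n} → All P′ (mids new) → (∀ {v} → P v → P′ (f v)) → Web E P n → Web E′ P′ (length new + n)
  extendWeb {P′} {n} newP′ oldP′ W = record
    { cells    = image (cells W)
    ; midpoint = All.++⁺ midpoint⁺ (All.map⁺ (All.map (λ {c} → f-midpoint c) (midpoint W)))
    ; strandˡ  = subst₂ (Strand _ _) eqᵐ eqˡ (extend f (strandˡ W) coverˡ enterˡ leaveˡ)
    ; strandʳ  = subst₂ (Strand _ _) eqᵐ eqʳ (extend f (strandʳ W) coverʳ enterʳ leaveʳ)
    ; range    = subst (All P′) eqᵐ (All.++⁺ newP′ (All.map⁺ (All.map oldP′ (range W))))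
    ; unique   = subst Unique eqᵐ (Unique.++⁺ unique⁺ (Unique.map⁺ f-injective (unique W)) disjoint)
    ; size     = begin
        length (image (cells W))                           ≡⟨ length-++ new ⟩
        length new + length (map (mapCell f) (cells W))    ≡⟨ cong (length new +_) (length-map (mapCell f) (cells W)) ⟩
        length new + length (cells W)                      ≤⟨ +-monoʳ-≤ (length new) (size W) ⟩
        length new + n                                     ∎
    }
    where
    open ≤-Reasoning
    eqᵐ = map-image mid (λ _ → refl) (cells W)
    eqˡ = map-image left (λ _ → refl) (cells W)
    eqʳ = map-image right (λ _ → refl) (cells W)

    f-midpoint : ∀ c → Midpoint c → Midpoint (mapCell f c)
    f-midpoint c = dilate-midpoint s t (left c) (mid c) (right c)

    f-injective : ∀ {x y} → f x ≡ f y → x ≡ y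
    f-injective {x} {y} eq = *-cancelˡ-≡ x y (suc s) (+-cancelʳ-≡ t (suc s * x) (suc s * y) eq)

    disjoint : ∀ {m} → ¬ (m ∈ mids new × m ∈ map f (mids (cells W)))
    disjoint (m∈new , m∈old) with v , v∈ , refl ← ∈-map⁻ f m∈old =
      All.lookup (fresh (All.lookup (range W) v∈)) m∈new refl

-- Reduction modulo p, which closes a web up to a configuration.

module _ (p : ℕ) .{{_ : NonZero p}} where

  reduce : ℕ → Fin p
  reduce n = n mod p

  toℕ-reduce : ∀ n → toℕ (reduce n) ≡ n % p
  toℕ-reduce n = toℕ-fromℕ< (m%n<n n p)

  reduce-cong : ∀ {m n} → m % p ≡ n % p → reduce m ≡ reduce n
  reduce-cong {m} {n} eq = toℕ-injective (trans (toℕ-reduce m) (trans eq (sym (toℕ-reduce n))))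

  reduce-injective : ∀ {m n} → reduce m ≡ reduce n → m % p ≡ n % p
  reduce-injective {m} {n} eq = trans (sym (toℕ-reduce m)) (trans (cong toℕ eq) (toℕ-reduce n))

  reduce-⊕ : ∀ m n → reduce m ⊕ reduce n ≡ reduce (m + n)
  reduce-⊕ m n = reduce-cong (trans (cong₂ (λ x y → (x + y) % p) (toℕ-reduce m) (toℕ-reduce n)) (sym (%-distribˡ-+ m n p)))

  -- Once entry and exit of a strand are congruent, its outgoing edge serves the vertex that the
  -- incoming edge served. `separate` keeps the vertices distinct.
  closeUp : ∀ {E P n} (W : Web E P n) → entryˡ E % p ≡ exitˡ E % p → entryʳ E % p ≡ exitʳ E % p →
            (∀ {x y} → P x → P y → x ≢ y → x % p ≢ y % p) →
            ∃[ c ] c ∈ cells W × left c % p ≢ right c % p →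
            ∃[ cs ] Configuration {p} cs × length cs ≤ n
  closeUp {n = n} W closeˡ closeʳ separate (c , c∈ , l≢r) = map (mapCell reduce) (cells W) , record
    { midpoint = All.map⁺ (All.map reduce-midpoint (midpoint W))
    ; unique   = subst Unique eqᵐ (unique-reduce (range W) (unique W))
    ; inLefts  = subst₂ (λ hs ms → All (_∈ hs) ms) (map-map (λ _ → refl) (cells W)) eqᵐ (closeStrand closeˡ (strandˡ W))
    ; inRights = subst₂ (λ hs ms → All (_∈ hs) ms) (map-map (λ _ → refl) (cells W)) eqᵐ (closeStrand closeʳ (strandʳ W))
    ; moved    = mapCell reduce c , ∈-map⁺ (mapCell reduce) c∈ , l≢r ∘ reduce-injective
    } , subst (_≤ n) (sym (length-map (mapCell reduce) (cells W))) (size W)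
    where
    eqᵐ : map reduce (mids (cells W)) ≡ mids (map (mapCell reduce) (cells W))
    eqᵐ = map-map (λ _ → refl) (cells W)

    reduce-midpoint : ∀ {d} → Midpoint d → reduce (left d) ⊕ reduce (right d) ≡ reduce (mid d) ⊕ reduce (mid d)
    reduce-midpoint {d} eq = trans (reduce-⊕ (left d) (right d)) (trans (cong reduce eq) (sym (reduce-⊕ (mid d) (mid d))))

    unique-reduce : ∀ {xs} → All _ xs → Unique xs → Unique (map reduce xs)
    unique-reduce All.[]         AllPairs.[]       = AllPairs.[]
    unique-reduce (px All.∷ pxs) (x≢ AllPairs.∷ u) =
      All.map⁺ (All.zipWith (λ (py , x≢y) → separate px py x≢y ∘ reduce-injective) (pxs , x≢)) AllPairs.∷ unique-reduce pxs u

    closeStrand : ∀ {u e ms hs} → u % p ≡ e % p → Strand u e ms hs → All (_∈ map reduce hs) (map reduce ms)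
    closeStrand {u} {e} {hs = hs} u≡e (strand covered e∈) = All.map⁺ (All.map close covered)
      where
      close : ∀ {m} → m ∈ u ∷ hs → reduce m ∈ map reduce hs
      close (here refl) = subst (_∈ map reduce hs) (sym (reduce-cong u≡e)) (∈-map⁺ reduce e∈)
      close (there m∈)  = ∈-map⁺ reduce m∈

-- Ends and ranges of webs, and separation of vertices modulo p.

straight twisted : ℕ → ℕ → Ends
straight A B = ends A (A + B) B 0
twisted  A B = ends B 0 A (A + B)

-- The third condition is v > (A - B) / 2; it separates the old vertices from the top vertex in
-- `Pad4.close`.
Inside : ℕ → ℕ → ℕ → Set
Inside A B v = 0 < v × v < A + B × A < v + v + B

Window : ℕ → ℕ → ℕ → Set
Window lo hi m = lo ≤ m × m ≤ hi

window⇒inside : ∀ {A B lo hi m} → 0 < lo → hi < A + B → A < lo + lo + B → Window lo hi m → Inside A B m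
window⇒inside {B = B} 0<lo hi<A+B A<2lo+B (lo≤m , m≤hi) =
  <-≤-trans 0<lo lo≤m , ≤-<-trans m≤hi hi<A+B , <-≤-trans A<2lo+B (+-monoˡ-≤ B (+-mono-≤ lo≤m lo≤m))

weaken : ∀ {E P P′ n n′} → (∀ {v} → P v → P′ v) → n ≤ n′ → Web E P n → Web E P′ n′
weaken P⇒P′ n≤n′ W = record
  { cells = cells W ; midpoint = midpoint W ; strandˡ = strandˡ W ; strandʳ = strandʳ W
  ; range = All.map P⇒P′ (range W) ; unique = unique W ; size = ≤-trans (size W) n≤n′ }

pattern #0 = here refl
pattern #1 = there #0
pattern #2 = there #1
pattern #3 = there #2
pattern #4 = there #3
pattern #5 = there #4

infixr 5 _∷ᵃ_
pattern _∷ᵃ_ x xs = All._∷_ x xs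
pattern []ᵃ = All.[]

dilate-< : ∀ s t {v w} → v < w → suc s * v + t < suc s * w + t
dilate-< s t v<w = +-monoˡ-< t (*-monoʳ-< (suc s) v<w)

dilate-≤ : ∀ s t {v w} → v ≤ w → suc s * v + t ≤ suc s * w + t
dilate-≤ s t v≤w = +-monoˡ-≤ t (*-monoʳ-≤ (suc s) v≤w)

descending : ∀ {a b c d} → d < c → c < b → b < a → Unique (a ∷ b ∷ c ∷ d ∷ [])
descending d<c c<b b<a =
  (>⇒≢ b<a ∷ᵃ >⇒≢ (<-trans c<b b<a) ∷ᵃ >⇒≢ (<-trans d<c (<-trans c<b b<a)) ∷ᵃ []ᵃ) AllPairs.∷
  (>⇒≢ c<b ∷ᵃ >⇒≢ (<-trans d<c c<b) ∷ᵃ []ᵃ) AllPairs.∷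
  (>⇒≢ d<c ∷ᵃ []ᵃ) AllPairs.∷ []ᵃ AllPairs.∷ AllPairs.[]

Closed : ℕ → ℕ → Set
Closed p n = ∃[ cs ] Configuration {p} cs × length cs ≤ n

-- If the residues agreed, `y ∸ x` would be a multiple of p strictly between 0 and 2p, hence p
-- itself.
mod-apart : ∀ {x y} p .{{_ : NonZero p}} → x < y → y < x + (p + p) → y ≢ x + p → x % p ≢ y % p
mod-apart {x} {y} p x<y y<x+2p y≢x+p x≡y = not-multiple p∣d
  where
  d = y ∸ x

  y≡x+d : y ≡ x + d
  y≡x+d = sym (m+[n∸m]≡n (<⇒≤ x<y))

  p∣d : p ∣ d
  p∣d = ∣m+n∣m⇒∣n (divides (y / p) (+-cancelˡ-≡ (x % p) (x / p * p + d) (y / p * p) (begin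
    x % p + (x / p * p + d)   ≡⟨ +-assoc (x % p) (x / p * p) d ⟨
    (x % p + x / p * p) + d   ≡⟨ cong (_+ d) (m≡m%n+[m/n]*n x p) ⟨
    x + d                     ≡⟨ y≡x+d ⟨
    y                         ≡⟨ m≡m%n+[m/n]*n y p ⟩
    y % p + y / p * p         ≡⟨ cong (_+ y / p * p) x≡y ⟨
    x % p + y / p * p         ∎))) (n∣m*n (x / p))
    where open ≡-Reasoning

  not-multiple : ¬ (p ∣ d)
  not-multiple (divides 0 d≡0)      = <⇒≢ x<y (sym (trans y≡x+d (trans (cong (x +_) d≡0) (+-identityʳ x))))
  not-multiple (divides 1 d≡p)      = y≢x+p (trans y≡x+d (cong (x +_) (trans d≡p (+-identityʳ p))))
  not-multiple (divides (2+ q) d≡p) = <⇒≱ y<x+2p (begin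
    x + (p + p)             ≤⟨ +-monoʳ-≤ x (+-monoʳ-≤ p (m≤m+n p (q * p))) ⟩
    x + (p + (p + q * p))   ≡⟨ cong (x +_) d≡p ⟨
    x + d                   ≡⟨ y≡x+d ⟨
    y                       ∎)
    where open ≤-Reasoning

-- The window may be longer than p, but only hi can lie p or more above another
-- number of this kind.
Sparse : ℕ → ℕ → ℕ → ℕ → Set
Sparse p lo hi m = Window lo hi m × m + p ≢ hi × (m ≡ hi ⊎ m < lo + p)

-- The numbers differ by less than 2p, so only y = x + p could go wrong. If y = hi, this contradicts
-- x + p ≢ hi; otherwise y < lo + p ≤ x + p.
sparse-apart : ∀ p .{{_ : NonZero p}} {lo hi} → hi < lo + (p + p) →
               ∀ {x y} → Sparse p lo hi x → Sparse p lo hi y → x ≢ y → x % p ≢ y % p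
sparse-apart p {lo} {hi} hi<lo+2p sx sy x≢y = [ ascending sx sy , ≢-sym ∘ ascending sy sx ]′ (≢⇒<⊎> x≢y)
  where
  ≢⇒<⊎> : ∀ {x y} → x ≢ y → x < y ⊎ y < x
  ≢⇒<⊎> {x} {y} x≢y with <-cmp x y
  ... | tri< x<y _ _ = inj₁ x<y
  ... | tri≈ _ x≡y _ = contradiction x≡y x≢y
  ... | tri> _ _ y<x = inj₂ y<x

  ascending : ∀ {x y} → Sparse p lo hi x → Sparse p lo hi y → x < y → x % p ≢ y % p
  ascending {x} {y} ((lo≤x , _) , x+p≢hi , _) ((_ , y≤hi) , _ , top) x<y =
    mod-apart p x<y (≤-<-trans y≤hi (<-≤-trans hi<lo+2p (+-monoˡ-≤ (p + p) lo≤x))) λ y≡x+p →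
      [ (λ y≡hi → x+p≢hi (trans (sym y≡x+p) y≡hi))
      , (λ y<lo+p → <⇒≱ y<lo+p (subst (lo + p ≤_) (sym y≡x+p) (+-monoˡ-≤ p lo≤x)))
      ]′ top

window⇒sparse : ∀ p {lo hi m} → hi < lo + p → Window lo hi m → Sparse p lo hi m
window⇒sparse p hi<lo+p w@(lo≤m , m≤hi) =
  w , >⇒≢ (<-≤-trans hi<lo+p (+-monoˡ-≤ p lo≤m)) , inj₂ (≤-<-trans m≤hi hi<lo+p)

closeStraight : ∀ {A p lo hi n} .{{_ : NonZero p}} (W : Web (straight A p) (Sparse p lo hi) n) → hi < lo + (p + p) →
                ∃[ c ] c ∈ cells W × left c % p ≢ right c % p → Closed p n
closeStraight {A} {p} W hi<lo+2p = closeUp p W (sym ([m+n]%n≡m%n A p)) ([m+n]%n≡m%n 0 p) (sparse-apart p hi<lo+2p)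

<lo+2p : ∀ {hi} lo p → hi < lo + p → hi < lo + (p + p)
<lo+2p lo p hi<lo+p = <-≤-trans hi<lo+p (+-monoʳ-≤ lo (m≤m+n p p))

descending-window : ∀ {a b c d} → d < c → c < b → b < a → All (Window d a) (a ∷ b ∷ c ∷ d ∷ [])
descending-window d<c c<b b<a =
  (<⇒≤ d<a , ≤-refl) ∷ᵃ (<⇒≤ (<-trans d<c c<b) , <⇒≤ b<a) ∷ᵃ (<⇒≤ d<c , <⇒≤ (<-trans c<b b<a)) ∷ᵃ (≤-refl , <⇒≤ d<a) ∷ᵃ []ᵃ
  where d<a = <-trans d<c (<-trans c<b b<a)

descending-gap : ∀ {a b c d x} → d < x → x < c → c < b → b < a → All (_≢ x) (a ∷ b ∷ c ∷ d ∷ [])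
descending-gap d<x x<c c<b b<a =
  >⇒≢ (<-trans x<b b<a) ∷ᵃ >⇒≢ x<b ∷ᵃ >⇒≢ x<c ∷ᵃ <⇒≢ d<x ∷ᵃ []ᵃ
  where x<b = <-trans x<c c<b

-- The gadgets: growing a web and closing it up.

-- In the gadgets f embeds the given web, whose outgoing edges now end at the new
-- vertices P and Q.  They were found by a search among small graphs for those
-- acting on the ratio (A − B) / (A + B) by an affine map.
module Step4 (A B : ℕ) (0<A : 0 < A) (0<B : 0 < B) (odd : ¬ (2 ∣ B)) where

  f : ℕ → ℕ
  f v = 2 * v + (2 * A + B)

  a P Q : ℕ
  a = 4 * A + 2 * B
  P = f (A + B)
  Q = f 0

  new newᵀ : List (Cell ℕ)
  new  = cell (f A) a P ∷ cell (Q + f B) P a ∷ cell a Q 0 ∷ []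
  newᵀ = cell P a (f A) ∷ cell (f B + Q) P a ∷ cell a Q 0 ∷ []

  Q<a : 2 * A + B < 4 * A + 2 * B
  Q<a = ≤-by (A + B) 0<A (solve (A ∷ B ∷ []))

  a<P : 4 * A + 2 * B < 2 * (A + B) + (2 * A + B)
  a<P = ≤-by 0 0<B (solve (A ∷ B ∷ []))

  midsUnique : Unique (a ∷ P ∷ Q ∷ [])
  midsUnique = (<⇒≢ a<P ∷ᵃ >⇒≢ Q<a ∷ᵃ []ᵃ) AllPairs.∷ (>⇒≢ (<-trans Q<a a<P) ∷ᵃ []ᵃ) AllPairs.∷ []ᵃ AllPairs.∷ AllPairs.[]

  -- Size does not separate `a` from the image of `f`, since Q < a < P. Parity does: `a` is even and
  -- `f v` is odd.
  a≢f : ∀ v → a ≢ f v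
  a≢f v a≡fv = odd (∣m+n∣m⇒∣n (divides (2 * A + B) (trans (reorder v) (trans (sym a≡fv) even))) (m∣m*n (v + A)))
    where
    reorder : ∀ v → 2 * (v + A) + B ≡ 2 * v + (2 * A + B)
    reorder v = solve (A ∷ B ∷ v ∷ [])
    even : 4 * A + 2 * B ≡ (2 * A + B) * 2
    even = solve (A ∷ B ∷ [])

  midsFresh : ∀ {v} → Inside A B v → All (_≢ f v) (a ∷ P ∷ Q ∷ [])
  midsFresh {v} (0<v , v<A+B , _) = a≢f v ∷ᵃ >⇒≢ (dilate-< 1 _ v<A+B) ∷ᵃ <⇒≢ (dilate-< 1 _ 0<v) ∷ᵃ []ᵃ

  midpoint-a : (2 * A + (2 * A + B)) + (2 * (A + B) + (2 * A + B)) ≡ (4 * A + 2 * B) + (4 * A + 2 * B)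
  midpoint-a = solve (A ∷ B ∷ [])

  midpoint-P : (2 * A + B + (2 * B + (2 * A + B))) + (4 * A + 2 * B) ≡ (2 * (A + B) + (2 * A + B)) + (2 * (A + B) + (2 * A + B))
  midpoint-P = solve (A ∷ B ∷ [])

  midpoint-Q : 4 * A + 2 * B + 0 ≡ (2 * A + B) + (2 * A + B)
  midpoint-Q = solve (A ∷ B ∷ [])

  extension : Extension (straight A B) (straight Q (f B)) (Inside A B) 1 (2 * A + B) new
  extension = record
    { midpoint⁺ = midpoint-a ∷ᵃ midpoint-P ∷ᵃ midpoint-Q ∷ᵃ []ᵃ
    ; coverˡ = #4 ∷ᵃ #0 ∷ᵃ #1 ∷ᵃ []ᵃ ; enterˡ = #1 ; leaveˡ = #1
    ; coverʳ = #3 ∷ᵃ #2 ∷ᵃ #0 ∷ᵃ []ᵃ ; enterʳ = #0 ; leaveʳ = #2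
    ; unique⁺ = midsUnique ; fresh = midsFresh
    }

  -- Gluing to the twisted web exchanges the two new sides; the cell at `a` swaps its heads to
  -- match.
  extensionᵀ : Extension (twisted A B) (straight (f B) Q) (Inside A B) 1 (2 * A + B) newᵀ
  extensionᵀ = record
    { midpoint⁺ = trans (+-comm P (f A)) midpoint-a ∷ᵃ trans (cong (_+ a) (+-comm (f B) Q)) midpoint-P ∷ᵃ midpoint-Q ∷ᵃ []ᵃ
    ; coverˡ = #4 ∷ᵃ #2 ∷ᵃ #0 ∷ᵃ []ᵃ ; enterˡ = #0 ; leaveˡ = #1
    ; coverʳ = #3 ∷ᵃ #0 ∷ᵃ #1 ∷ᵃ []ᵃ ; enterʳ = #1 ; leaveʳ = #2
    ; unique⁺ = midsUnique ; fresh = midsFresh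
    }

  Q≤P : Q ≤ P
  Q≤P = <⇒≤ (<-trans Q<a a<P)

  window : All (Window Q P) (a ∷ P ∷ Q ∷ [])
  window = (<⇒≤ Q<a , <⇒≤ a<P) ∷ᵃ (Q≤P , ≤-refl) ∷ᵃ (≤-refl , Q≤P) ∷ᵃ []ᵃ

  windowᶠ : ∀ {v} → Inside A B v → Window Q P (f v)
  windowᶠ {v} (_ , v<A+B , _) = dilate-≤ 1 _ {0} {v} z≤n , <⇒≤ (dilate-< 1 _ v<A+B)

  0<Q : 0 < 2 * A + B
  0<Q = ≤-by (A + B) 0<A (solve (A ∷ B ∷ []))

  P<total : 2 * (A + B) + (2 * A + B) < 2 * A + B + (2 * B + (2 * A + B))
  P<total = ≤-by 0 0<B (solve (A ∷ B ∷ []))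

  -- The new pair is (2A + B, 2A + 3B), with ratio (x - 1) / 4; `growᵀ` has the opposite ratio.
  grow : ∀ {n} → Web (straight A B) (Inside A B) n → Web (straight Q (f B)) (Inside Q (f B)) (3 + n)
  grow W = weaken (window⇒inside 0<Q P<total low) ≤-refl (extendWeb extension window windowᶠ W)
    where
    low : 2 * A + B < 2 * A + B + (2 * A + B) + (2 * B + (2 * A + B))
    low = ≤-by (3 * A + 4 * B) 0<A (solve (A ∷ B ∷ []))

  growᵀ : ∀ {n} → Web (straight A B) (Inside A B) n → Web (straight (f B) Q) (Inside (f B) Q) (3 + n)
  growᵀ W = weaken (window⇒inside 0<Q (subst (P <_) (+-comm Q (f B)) P<total) low) ≤-refl (extendWeb extensionᵀ window windowᶠ (twist W))
    where
    low : 2 * B + (2 * A + B) < 2 * A + B + (2 * A + B) + (2 * A + B)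
    low = ≤-by (3 * A) 0<A (solve (A ∷ B ∷ []))

  -- `P<total` also says that the window from Q to P is shorter than the side `f B`, so its points
  -- have distinct residues.
  close : ∀ .{{_ : NonZero (f B)}} {n} → Web (straight A B) (Inside A B) n → Closed (f B) (3 + n)
  close W = closeStraight W′ (<lo+2p Q (f B) P<total) (cell (Q + f B) P a , #1 , ≢-sym (mod-apart (f B) a<T T<a+2p T≢a+p))
    where
    W′ = weaken (window⇒sparse (f B) P<total) ≤-refl (extendWeb extension window windowᶠ W)
    a<T : 4 * A + 2 * B < 2 * A + B + (2 * B + (2 * A + B))
    a<T = ≤-by B 0<B (solve (A ∷ B ∷ []))
    T<a+p : 2 * A + B + (2 * B + (2 * A + B)) < 4 * A + 2 * B + (2 * B + (2 * A + B))
    T<a+p = ≤-by (A + B) 0<A (solve (A ∷ B ∷ []))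
    T<a+2p = <lo+2p a (f B) T<a+p
    T≢a+p = <⇒≢ T<a+p

-- The new pair is (4A + 3B, 4A + 5B), with ratio (x - 1) / 8, or the reverse. The old vertices land
-- strictly between Q and P, and P < b < a, so size alone keeps the new vertices fresh.
module Step8 (A B : ℕ) (0<A : 0 < A) (0<B : 0 < B) where

  f : ℕ → ℕ
  f v = 2 * v + (2 * A + 3 * B)

  a b P Q : ℕ
  a = 6 * A + 7 * B
  b = 4 * A + 6 * B
  P = f (A + B)
  Q = f 0

  new newᵀ : List (Cell ℕ)
  new  = cell (f A + P) a b ∷ cell a b (f B) ∷ cell Q P a ∷ cell b Q 0 ∷ []
  newᵀ = cell (P + f A) a b ∷ cell (f B) b a ∷ cell a P Q ∷ cell b Q 0 ∷ []

  Q<P : 2 * A + 3 * B < 2 * (A + B) + (2 * A + 3 * B)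
  Q<P = ≤-by (A + 2 * B) 0<A (solve (A ∷ B ∷ []))

  P<b : 2 * (A + B) + (2 * A + 3 * B) < 4 * A + 6 * B
  P<b = ≤-by 0 0<B (solve (A ∷ B ∷ []))

  b<a : 4 * A + 6 * B < 6 * A + 7 * B
  b<a = ≤-by (2 * A) 0<B (solve (A ∷ B ∷ []))

  midsFresh : ∀ {v} → Inside A B v → All (_≢ f v) (a ∷ b ∷ P ∷ Q ∷ [])
  midsFresh (0<v , v<A+B , _) = descending-gap (dilate-< 1 _ 0<v) (dilate-< 1 _ v<A+B) P<b b<a

  midpoint-a : (2 * A + (2 * A + 3 * B) + (2 * (A + B) + (2 * A + 3 * B))) + (4 * A + 6 * B) ≡ (6 * A + 7 * B) + (6 * A + 7 * B)
  midpoint-a = solve (A ∷ B ∷ [])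

  midpoint-b : (6 * A + 7 * B) + (2 * B + (2 * A + 3 * B)) ≡ (4 * A + 6 * B) + (4 * A + 6 * B)
  midpoint-b = solve (A ∷ B ∷ [])

  midpoint-P : (2 * A + 3 * B) + (6 * A + 7 * B) ≡ (2 * (A + B) + (2 * A + 3 * B)) + (2 * (A + B) + (2 * A + 3 * B))
  midpoint-P = solve (A ∷ B ∷ [])

  midpoint-Q : 4 * A + 6 * B + 0 ≡ (2 * A + 3 * B) + (2 * A + 3 * B)
  midpoint-Q = solve (A ∷ B ∷ [])

  extension : Extension (straight A B) (straight (f A) P) (Inside A B) 1 (2 * A + 3 * B) new
  extension = record
    { midpoint⁺ = midpoint-a ∷ᵃ midpoint-b ∷ᵃ midpoint-P ∷ᵃ midpoint-Q ∷ᵃ []ᵃ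
    ; coverˡ = #3 ∷ᵃ #5 ∷ᵃ #0 ∷ᵃ #4 ∷ᵃ []ᵃ ; enterˡ = #0 ; leaveˡ = #0
    ; coverʳ = #4 ∷ᵃ #2 ∷ᵃ #1 ∷ᵃ #0 ∷ᵃ []ᵃ ; enterʳ = #2 ; leaveʳ = #3
    ; unique⁺ = descending Q<P P<b b<a ; fresh = midsFresh
    }

  extensionᵀ : Extension (twisted A B) (straight P (f A)) (Inside A B) 1 (2 * A + 3 * B) newᵀ
  extensionᵀ = record
    { midpoint⁺ = trans (cong (_+ b) (+-comm P (f A))) midpoint-a ∷ᵃ trans (+-comm (f B) a) midpoint-b ∷ᵃ trans (+-comm a Q) midpoint-P ∷ᵃ midpoint-Q ∷ᵃ []ᵃ
    ; coverˡ = #4 ∷ᵃ #5 ∷ᵃ #1 ∷ᵃ #0 ∷ᵃ []ᵃ ; enterˡ = #2 ; leaveˡ = #0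
    ; coverʳ = #3 ∷ᵃ #2 ∷ᵃ #0 ∷ᵃ #4 ∷ᵃ []ᵃ ; enterʳ = #0 ; leaveʳ = #3
    ; unique⁺ = descending Q<P P<b b<a ; fresh = midsFresh
    }

  window : All (Window Q a) (a ∷ b ∷ P ∷ Q ∷ [])
  window = descending-window Q<P P<b b<a

  windowᶠ : ∀ {v} → Inside A B v → Window Q a (f v)
  windowᶠ {v} (_ , v<A+B , _) = dilate-≤ 1 _ {0} {v} z≤n , <⇒≤ (<-trans (dilate-< 1 _ v<A+B) (<-trans P<b b<a))

  0<Q : 0 < 2 * A + 3 * B
  0<Q = ≤-by (A + 3 * B) 0<A (solve (A ∷ B ∷ []))

  a<total : 6 * A + 7 * B < 2 * A + (2 * A + 3 * B) + (2 * (A + B) + (2 * A + 3 * B))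
  a<total = ≤-by (2 * A) 0<B (solve (A ∷ B ∷ []))

  grow : ∀ {n} → Web (straight A B) (Inside A B) n → Web (straight (f A) P) (Inside (f A) P) (4 + n)
  grow W = weaken (window⇒inside 0<Q a<total low) ≤-refl (extendWeb extension window windowᶠ W)
    where
    low : 2 * A + (2 * A + 3 * B) < 2 * A + 3 * B + (2 * A + 3 * B) + (2 * (A + B) + (2 * A + 3 * B))
    low = ≤-by (3 * A + 8 * B) 0<A (solve (A ∷ B ∷ []))

  growᵀ : ∀ {n} → Web (straight A B) (Inside A B) n → Web (straight P (f A)) (Inside P (f A)) (4 + n)
  growᵀ W = weaken (window⇒inside 0<Q (subst (a <_) (+-comm (f A) P) a<total) low) ≤-refl (extendWeb extensionᵀ window windowᶠ (twist W))
    where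
    low : 2 * (A + B) + (2 * A + 3 * B) < 2 * A + 3 * B + (2 * A + 3 * B) + (2 * A + (2 * A + 3 * B))
    low = ≤-by (3 * A + 4 * B) 0<A (solve (A ∷ B ∷ []))

  b<total : 4 * A + 6 * B < 2 * A + (2 * A + 3 * B) + (2 * (A + B) + (2 * A + 3 * B))
  b<total = ≤-by (3 * A + 2 * B) 0<A (solve (A ∷ B ∷ []))

  close : ∀ .{{_ : NonZero P}} {n} → Web (straight A B) (Inside A B) n → Closed P (4 + n)
  close W = closeStraight W′ (<lo+2p Q P a<Q+p) (cell (f A + P) a b , #0 , ≢-sym (mod-apart P b<total (<lo+2p b P total<b+p) (<⇒≢ total<b+p)))
    where
    a<Q+p : 6 * A + 7 * B < 2 * A + 3 * B + (2 * (A + B) + (2 * A + 3 * B))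
    a<Q+p = ≤-by 0 0<B (solve (A ∷ B ∷ []))
    W′ = weaken (window⇒sparse P a<Q+p) ≤-refl (extendWeb extension window windowᶠ W)
    total<b+p : 2 * A + (2 * A + 3 * B) + (2 * (A + B) + (2 * A + 3 * B)) < 4 * A + 6 * B + (2 * (A + B) + (2 * A + 3 * B))
    total<b+p = ≤-by (2 * B) 0<B (solve (A ∷ B ∷ []))

  -- The window has length 4A + 4B, more than the side 4A + 3B, but only its top `a` lies a full
  -- side or more above Q. It remains to see that no vertex plus the side equals `a`.
  closeᵀ : ∀ .{{_ : NonZero (f A)}} {n} → ¬ (2 ∣ B) → Web (straight A B) (Inside A B) n → Closed (f A) (4 + n)
  closeᵀ {n} odd W = closeStraight W′ a<Q+2p
    (cell (P + f A) a b , #0 , ≢-sym (mod-apart (f A) (subst (b <_) (+-comm (f A) P) b<total) (<lo+2p b (f A) total<b+p) (<⇒≢ total<b+p)))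
    where
    a<Q+2p : 6 * A + 7 * B < 2 * A + 3 * B + (2 * A + (2 * A + 3 * B) + (2 * A + (2 * A + 3 * B)))
    a<Q+2p = ≤-by (3 * A + 2 * B) 0<A (solve (A ∷ B ∷ []))
    b<Q+p : 4 * A + 6 * B < 2 * A + 3 * B + (2 * A + (2 * A + 3 * B))
    b<Q+p = ≤-by A 0<A (solve (A ∷ B ∷ []))
    a<P+p : 6 * A + 7 * B < 2 * (A + B) + (2 * A + 3 * B) + (2 * A + (2 * A + 3 * B))
    a<P+p = ≤-by (2 * A) 0<B (solve (A ∷ B ∷ []))
    Q+p<a : 2 * A + 3 * B + (2 * A + (2 * A + 3 * B)) < 6 * A + 7 * B
    Q+p<a = ≤-by 0 0<B (solve (A ∷ B ∷ []))

    -- Equality would give B = 2v.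
    f+p≢a : ∀ v → f v + f A ≢ a
    f+p≢a v eq = odd (divides v (trans (+-cancelʳ-≡ (6 * A + 6 * B) B (2 * v) (trans shift (trans (sym eq) reorder))) (*-comm 2 v)))
      where
      shift : B + (6 * A + 6 * B) ≡ 6 * A + 7 * B
      shift = solve (A ∷ B ∷ [])
      reorder : 2 * v + (2 * A + 3 * B) + (2 * A + (2 * A + 3 * B)) ≡ 2 * v + (6 * A + 6 * B)
      reorder = solve (A ∷ B ∷ v ∷ [])

    sparse : ∀ {m} → Window Q a m → m + f A ≢ a → m ≡ a ⊎ m ≤ b → Sparse (f A) Q a m
    sparse w m+p≢a (inj₁ m≡a) = w , m+p≢a , inj₁ m≡a
    sparse w m+p≢a (inj₂ m≤b) = w , m+p≢a , inj₂ (≤-<-trans m≤b b<Q+p)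

    0<p : 0 < f A
    0<p = >-nonZero⁻¹ (f A)

    newSparse : All (Sparse (f A) Q a) (a ∷ b ∷ P ∷ Q ∷ [])
    newSparse =
      sparse (All.lookup window #0) (>⇒≢ (m<m+n a 0<p)) (inj₁ refl) ∷ᵃ
      sparse (All.lookup window #1) (>⇒≢ (<-trans a<P+p (+-monoˡ-< (f A) P<b))) (inj₂ ≤-refl) ∷ᵃ
      sparse (All.lookup window #2) (>⇒≢ a<P+p) (inj₂ (<⇒≤ P<b)) ∷ᵃ
      sparse (All.lookup window #3) (<⇒≢ Q+p<a) (inj₂ (<⇒≤ (<-trans Q<P P<b))) ∷ᵃ []ᵃ

    oldSparse : ∀ {v} → Inside A B v → Sparse (f A) Q a (f v)
    oldSparse {v} i@(_ , v<A+B , _) = sparse (windowᶠ i) (f+p≢a v) (inj₂ (<⇒≤ (<-trans (dilate-< 1 _ v<A+B) P<b)))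

    W′ : Web (straight P (f A)) (Sparse (f A) Q a) (4 + n)
    W′ = extendWeb extensionᵀ newSparse oldSparse (twist W)

    total<b+p : 2 * (A + B) + (2 * A + 3 * B) + (2 * A + (2 * A + 3 * B)) < 4 * A + 6 * B + (2 * A + (2 * A + 3 * B))
    total<b+p = ≤-by 0 0<B (solve (A ∷ B ∷ []))

-- Both sides gain 3w, so the sum 2w becomes 8w and the ratio x becomes x / 4. The new vertices are
-- 3w, 5w, 6w and 7w, the second being `P`.
module Pad4 (A B w : ℕ) (0<A : 0 < A) (0<B : 0 < B) (0<w : 0 < w) (sum : A + B ≡ 2 * w) where

  f : ℕ → ℕ
  f v = 1 * v + 3 * w

  a b P Q : ℕ
  a = 7 * w
  b = 6 * w
  P = f (A + B)
  Q = f 0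

  new : List (Cell ℕ)
  new = cell (f A + f B) a b ∷ cell a b P ∷ cell Q P a ∷ cell b Q 0 ∷ []

  sum≤ : A + B ≤ 2 * w
  sum≤ = ≤-reflexive sum

  sum≥ : 2 * w ≤ A + B
  sum≥ = ≤-reflexive (sym sum)

  Q<P : 3 * w < 1 * (A + B) + 3 * w
  Q<P = ≤-by B 0<A (solve (A ∷ B ∷ w ∷ []))

  P<b : 1 * (A + B) + 3 * w < 6 * w
  P<b = ≤-by 0 (+-mono-≤ sum≤ 0<w) (solve (A ∷ B ∷ w ∷ []))

  b<a : 6 * w < 7 * w
  b<a = ≤-by 0 0<w (solve (w ∷ []))

  midsFresh : ∀ {v} → Inside A B v → All (_≢ f v) (a ∷ b ∷ P ∷ Q ∷ [])
  midsFresh (0<v , v<A+B , _) = descending-gap (dilate-< 0 _ 0<v) (dilate-< 0 _ v<A+B) P<b b<a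

  midpoint-a : (1 * A + 3 * w + (1 * B + 3 * w)) + 6 * w ≡ 7 * w + 7 * w
  midpoint-a = begin
    (1 * A + 3 * w + (1 * B + 3 * w)) + 6 * w ≡⟨ solve (A ∷ B ∷ w ∷ []) ⟩
    (A + B) + 12 * w                           ≡⟨ cong (_+ 12 * w) sum ⟩
    2 * w + 12 * w                             ≡⟨ solve (w ∷ []) ⟩
    7 * w + 7 * w                            ∎
    where open ≡-Reasoning

  midpoint-b : 7 * w + (1 * (A + B) + 3 * w) ≡ 6 * w + 6 * w
  midpoint-b = begin
    7 * w + (1 * (A + B) + 3 * w) ≡⟨ solve (A ∷ B ∷ w ∷ []) ⟩
    (A + B) + 10 * w               ≡⟨ cong (_+ 10 * w) sum ⟩
    2 * w + 10 * w                 ≡⟨ solve (w ∷ []) ⟩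
    6 * w + 6 * w                ∎
    where open ≡-Reasoning

  midpoint-P : 3 * w + 7 * w ≡ (1 * (A + B) + 3 * w) + (1 * (A + B) + 3 * w)
  midpoint-P = begin
    3 * w + 7 * w                                    ≡⟨ solve (w ∷ []) ⟩
    2 * w + 2 * w + 6 * w                            ≡⟨ cong (λ x → x + x + 6 * w) sum ⟨
    (A + B) + (A + B) + 6 * w                        ≡⟨ solve (A ∷ B ∷ w ∷ []) ⟩
    (1 * (A + B) + 3 * w) + (1 * (A + B) + 3 * w)     ∎
    where open ≡-Reasoning

  midpoint-Q : 6 * w + 0 ≡ 3 * w + 3 * w
  midpoint-Q = solve (w ∷ [])

  extension : Extension (straight A B) (straight (f A) (f B)) (Inside A B) 0 (3 * w) new
  extension = record
    { midpoint⁺ = midpoint-a ∷ᵃ midpoint-b ∷ᵃ midpoint-P ∷ᵃ midpoint-Q ∷ᵃ []ᵃ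
    ; coverˡ = #3 ∷ᵃ #5 ∷ᵃ #0 ∷ᵃ #4 ∷ᵃ []ᵃ ; enterˡ = #0 ; leaveˡ = #0
    ; coverʳ = #4 ∷ᵃ #2 ∷ᵃ #3 ∷ᵃ #0 ∷ᵃ []ᵃ ; enterʳ = #0 ; leaveʳ = #3
    ; unique⁺ = descending Q<P P<b b<a ; fresh = midsFresh
    }

  window : All (Window Q a) (a ∷ b ∷ P ∷ Q ∷ [])
  window = descending-window Q<P P<b b<a

  windowᶠ : ∀ {v} → Inside A B v → Window Q a (f v)
  windowᶠ {v} (_ , v<A+B , _) = dilate-≤ 0 _ {0} {v} z≤n , <⇒≤ (<-trans (dilate-< 0 _ v<A+B) (<-trans P<b b<a))

  grow : ∀ {n} → Web (straight A B) (Inside A B) n → Web (straight (f A) (f B)) (Inside (f A) (f B)) (4 + n)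
  grow W = weaken (window⇒inside 0<Q a<total low) ≤-refl (extendWeb extension window windowᶠ W)
    where
    0<Q : 0 < 3 * w
    0<Q = ≤-by (2 * w) 0<w (solve (w ∷ []))
    a<total : 7 * w < 1 * A + 3 * w + (1 * B + 3 * w)
    a<total = ≤-by 0 (+-mono-≤ sum≥ 0<w) (solve (A ∷ B ∷ w ∷ []))
    low : 1 * A + 3 * w < 3 * w + 3 * w + (1 * B + 3 * w)
    low = ≤-by (3 * w + 2 * B) (+-mono-≤ sum≤ 0<w) (solve (A ∷ B ∷ w ∷ []))

  -- The window from 3w to 7w can be longer than the side B + 3w, so no vertex plus the side may
  -- equal 7w. For `Q` this would force B = w, against parity; for `f v` the third condition of
  -- `Inside` makes the sum exceed 7w.
  close : ∀ .{{_ : NonZero (f B)}} {n} → 2 ∣ w → ¬ (2 ∣ B) → Web (straight A B) (Inside A B) n → Closed (f B) (4 + n)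
  close {n} even odd W = closeStraight W′ a<Q+2p
    (cell (f A + f B) a b , #0 , ≢-sym (mod-apart (f B) b<total (<lo+2p b (f B) total<b+p) (<⇒≢ total<b+p)))
    where
    a<Q+2p : 7 * w < 3 * w + (1 * B + 3 * w + (1 * B + 3 * w))
    a<Q+2p = ≤-by (w + 2 * B) 0<w (solve (B ∷ w ∷ []))
    b<Q+p : 6 * w < 3 * w + (1 * B + 3 * w)
    b<Q+p = ≤-by 0 0<B (solve (B ∷ w ∷ []))
    a<b+p : 7 * w < 6 * w + (1 * B + 3 * w)
    a<b+p = ≤-by (w + B) 0<w (solve (B ∷ w ∷ []))
    a<P+p : 7 * w < 1 * (A + B) + 3 * w + (1 * B + 3 * w)
    a<P+p = ≤-by w (+-mono-≤ sum≥ 0<B) (solve (A ∷ B ∷ w ∷ []))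
    b<total : 6 * w < 1 * A + 3 * w + (1 * B + 3 * w)
    b<total = ≤-by B 0<A (solve (A ∷ B ∷ w ∷ []))
    total<b+p : 1 * A + 3 * w + (1 * B + 3 * w) < 6 * w + (1 * B + 3 * w)
    total<b+p = ≤-by B (+-mono-≤ sum≤ 0<w) (solve (A ∷ B ∷ w ∷ []))

    Q+p≢a : Q + f B ≢ a
    Q+p≢a eq = odd (subst (2 ∣_) (sym (+-cancelʳ-≡ (6 * w) B w (trans reorder (trans eq split)))) even)
      where
      reorder : B + 6 * w ≡ 3 * w + (1 * B + 3 * w)
      reorder = solve (B ∷ w ∷ [])
      split : 7 * w ≡ w + 6 * w
      split = solve (w ∷ [])

    a<f+p : ∀ {v} → A < v + v + B → 7 * w < 1 * v + 3 * w + (1 * B + 3 * w)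
    a<f+p {v} A<2v+B = ≤-by 0 (*-cancelˡ-< 2 w (v + B) doubled) (solve (B ∷ w ∷ v ∷ []))
      where
      doubled : 2 * w < 2 * (v + B)
      doubled = ≤-by 0 (+-mono-≤ sum≥ A<2v+B) (solve (A ∷ B ∷ w ∷ v ∷ []))

    sparse : ∀ {m} → Window Q a m → m + f B ≢ a → m ≡ a ⊎ m ≤ b → Sparse (f B) Q a m
    sparse w m+p≢a (inj₁ m≡a) = w , m+p≢a , inj₁ m≡a
    sparse w m+p≢a (inj₂ m≤b) = w , m+p≢a , inj₂ (≤-<-trans m≤b b<Q+p)

    newSparse : All (Sparse (f B) Q a) (a ∷ b ∷ P ∷ Q ∷ [])
    newSparse =
      sparse (All.lookup window #0) (>⇒≢ (m<m+n a (>-nonZero⁻¹ (f B)))) (inj₁ refl) ∷ᵃ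
      sparse (All.lookup window #1) (>⇒≢ a<b+p) (inj₂ ≤-refl) ∷ᵃ
      sparse (All.lookup window #2) (>⇒≢ a<P+p) (inj₂ (<⇒≤ P<b)) ∷ᵃ
      sparse (All.lookup window #3) Q+p≢a (inj₂ (<⇒≤ (<-trans Q<P P<b))) ∷ᵃ []ᵃ

    oldSparse : ∀ {v} → Inside A B v → Sparse (f B) Q a (f v)
    oldSparse {v} i@(_ , v<A+B , A<2v+B) = sparse (windowᶠ i) (>⇒≢ (a<f+p {v} A<2v+B)) (inj₂ (<⇒≤ (<-trans (dilate-< 0 _ v<A+B) P<b)))

    W′ : Web (straight (f A) (f B)) (Sparse (f B) Q a) (4 + n)
    W′ = extendWeb extension newSparse oldSparse W

-- Closing a web up with side 2A + B instead of stepping to Step4.growᵀ, where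
-- two vertices would become congruent modulo that side.
module Cap3 (A B : ℕ) (0<A : 0 < A) (0<B : 0 < B) where

  f : ℕ → ℕ
  f v = 1 * v + (A + B)

  P Q : ℕ
  P = f (A + B)
  Q = f 0

  new : List (Cell ℕ)
  new = cell Q P (f B + f A) ∷ cell 0 Q P ∷ []

  Q<P : A + B < 1 * (A + B) + (A + B)
  Q<P = ≤-by B 0<A (solve (A ∷ B ∷ []))

  midpoint-P : (A + B) + (1 * B + (A + B) + (1 * A + (A + B))) ≡ (1 * (A + B) + (A + B)) + (1 * (A + B) + (A + B))
  midpoint-P = solve (A ∷ B ∷ [])

  midpoint-Q : 0 + (1 * (A + B) + (A + B)) ≡ (A + B) + (A + B)
  midpoint-Q = solve (A ∷ B ∷ [])

  -- These are the ends of `twisted (f B) (f A)`, so both strands close up modulo `f A`, which is 2A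
  -- + B.
  extension : Extension (straight A B) (ends (f A) 0 (f B) (f B + f A)) (Inside A B) 0 (A + B) new
  extension = record
    { midpoint⁺ = midpoint-P ∷ᵃ midpoint-Q ∷ᵃ []ᵃ
    ; coverˡ = #0 ∷ᵃ #2 ∷ᵃ []ᵃ ; enterˡ = #0 ; leaveˡ = #1
    ; coverʳ = #3 ∷ᵃ #0 ∷ᵃ []ᵃ ; enterʳ = #0 ; leaveʳ = #0
    ; unique⁺ = (>⇒≢ Q<P ∷ᵃ []ᵃ) AllPairs.∷ []ᵃ AllPairs.∷ AllPairs.[]
    ; fresh = λ {v} (0<v , v<A+B , _) → >⇒≢ (dilate-< 0 (A + B) v<A+B) ∷ᵃ <⇒≢ (dilate-< 0 (A + B) 0<v) ∷ᵃ []ᵃ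
    }

  close : ∀ .{{_ : NonZero (f A)}} {n} → Web (straight A B) (Inside A B) n → Closed (f A) (2 + n)
  close {n} W = closeUp (f A) W′ ([m+n]%n≡m%n 0 (f A)) (sym ([m+n]%n≡m%n (f B) (f A))) (sparse-apart (f A) (<lo+2p Q (f A) P<Q+p))
    (cell 0 Q P , #1 , mod-apart (f A) (≤-<-trans z≤n Q<P) P<2p (>⇒≢ p<P))
    where
    P<Q+p : 1 * (A + B) + (A + B) < A + B + (1 * A + (A + B))
    P<Q+p = ≤-by 0 0<A (solve (A ∷ B ∷ []))
    P<2p : 1 * (A + B) + (A + B) < 0 + (1 * A + (A + B) + (1 * A + (A + B)))
    P<2p = ≤-by A 0<A (solve (A ∷ B ∷ []))
    p<P : 1 * A + (A + B) < 1 * (A + B) + (A + B)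
    p<P = ≤-by 0 0<B (solve (A ∷ B ∷ []))
    W′ : Web (ends (f A) 0 (f B) (f B + f A)) (Sparse (f A) Q P) (2 + n)
    W′ = extendWeb extension
      (window⇒sparse (f A) P<Q+p (<⇒≤ Q<P , ≤-refl) ∷ᵃ window⇒sparse (f A) P<Q+p (≤-refl , <⇒≤ Q<P) ∷ᵃ []ᵃ)
      (λ {v} (_ , v<A+B , _) → window⇒sparse (f A) P<Q+p (dilate-≤ 0 _ {0} {v} z≤n , <⇒≤ (dilate-< 0 _ v<A+B))) W

-- Balanced pairs and the descent on them.

-- The bounds say that neither of A and B exceeds twice the other.
record Balanced (w A B : ℕ) : Set where
  field
    sum  : A + B ≡ 2 * w
    oddˡ : ¬ (2 ∣ A)
    oddʳ : ¬ (2 ∣ B)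
    lowˡ : 2 * w ≤ 3 * A
    lowʳ : 2 * w ≤ 3 * B
open Balanced

Balanced-sym : ∀ {w A B} → Balanced w A B → Balanced w B A
Balanced-sym {A = A} {B} b = record
  { sum = trans (+-comm B A) (sum b) ; oddˡ = oddʳ b ; oddʳ = oddˡ b ; lowˡ = lowʳ b ; lowʳ = lowˡ b }

half-≤ : ∀ {A B} w → A + B ≡ 2 * w → A ≤ B → A ≤ w
half-≤ {A} {B} w sum A≤B = *-cancelˡ-≤ 2 (≤-by 0 (+-mono-≤ A≤B (≤-reflexive sum)) (solve (A ∷ B ∷ w ∷ [])))

odd⇒positive : ∀ {n} → ¬ (2 ∣ n) → 0 < n
odd⇒positive {zero}  odd = contradiction (2 ∣0) odd
odd⇒positive {suc _} _   = z<s

3*-cancel-≤ : ∀ {m n} → 3 * m ≤ 3 * n → m ≤ n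
3*-cancel-≤ = *-cancelˡ-≤ 3

-- Inverts the map of `Step4`: a = A - 2w and b = 4w - A, passed as witnesses to avoid truncated
-- subtraction. The bounds 2w ≤ 3a and 2w ≤ 3b amount to 8w ≤ 3A and 3A ≤ 10w.
split-Step4 : ∀ {w A B} → ∃[ a ] 2 * w + a ≡ A → ∃[ b ] A + b ≡ 2 * (2 * w) →
              Balanced (2 * (2 * w)) A B → 3 * A ≤ 10 * w →
              ∃₂ λ a b → Balanced w a b × 2 * a + b ≡ A × 2 * b + (2 * a + b) ≡ B
split-Step4 {w} {A} {B} (a , refl) (b , A+b≡4w) bal upper = a , b , record
  { sum  = a+b≡2w
  ; oddˡ = λ 2∣a → oddˡ bal (∣m∣n⇒∣m+n (m∣m*n w) 2∣a)
  ; oddʳ = λ 2∣b → oddˡ bal (∣m+n∣m⇒∣n (subst (2 ∣_) (trans (sym A+b≡4w) (+-comm A b)) (m∣m*n (2 * w))) 2∣b)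
  ; lowˡ = ≤-by 0 (lowˡ bal) (solve (a ∷ w ∷ []))
  ; lowʳ = ≤-by 0 (+-mono-≤ upper 6w≤) (solve (a ∷ b ∷ w ∷ []))
  } , eqA , +-cancelˡ-≡ (2 * w + a) (2 * b + (2 * a + b)) B (trans eqB (sym (sum bal)))
  where
  open ≡-Reasoning
  a+b≡2w : a + b ≡ 2 * w
  a+b≡2w = +-cancelˡ-≡ (2 * w) (a + b) (2 * w) (begin
    2 * w + (a + b) ≡⟨ +-assoc (2 * w) a b ⟨
    2 * w + a + b   ≡⟨ A+b≡4w ⟩
    2 * (2 * w)     ≡⟨ solve (w ∷ []) ⟩
    2 * w + 2 * w   ∎)
  6w≤ : 3 * (2 * w) ≤ 3 * (a + b)
  6w≤ = *-monoʳ-≤ 3 (≤-reflexive (sym a+b≡2w))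
  eqA : 2 * a + b ≡ 2 * w + a
  eqA = begin
    2 * a + b   ≡⟨ solve (a ∷ b ∷ []) ⟩
    a + b + a   ≡⟨ cong (_+ a) a+b≡2w ⟩
    2 * w + a   ∎
  eqB : 2 * w + a + (2 * b + (2 * a + b)) ≡ 2 * (2 * (2 * w))
  eqB = begin
    2 * w + a + (2 * b + (2 * a + b)) ≡⟨ solve (a ∷ b ∷ w ∷ []) ⟩
    2 * w + 3 * (a + b)               ≡⟨ cong (λ x → 2 * w + 3 * x) a+b≡2w ⟩
    2 * w + 3 * (2 * w)               ≡⟨ solve (w ∷ []) ⟩
    2 * (2 * (2 * w))                 ∎

-- Inverts the map of `Step8`: a = A - 6w and b = 8w - A. The two bounds on 3A are those of balance
-- for a and b.
split-Step8 : ∀ {w A B} → ∃[ a ] 6 * w + a ≡ A → ∃[ b ] A + b ≡ 2 * (2 * (2 * w)) →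
              Balanced (2 * (2 * (2 * w))) A B → 20 * w ≤ 3 * A → 3 * A ≤ 22 * w →
              ∃₂ λ a b → Balanced w a b × 2 * a + (2 * a + 3 * b) ≡ A × 2 * (a + b) + (2 * a + 3 * b) ≡ B
split-Step8 {w} {A} {B} (a , refl) (b , A+b≡8w) bal lower upper = a , b , record
  { sum  = a+b≡2w
  ; oddˡ = λ 2∣a → oddˡ bal (∣m∣n⇒∣m+n (∣m⇒∣m*n w (divides 3 refl)) 2∣a)
  ; oddʳ = λ 2∣b → oddˡ bal (∣m+n∣m⇒∣n (subst (2 ∣_) (trans (sym A+b≡8w) (+-comm A b)) (m∣m*n (2 * (2 * w)))) 2∣b)
  ; lowˡ = ≤-by 0 lower (solve (a ∷ w ∷ []))
  ; lowʳ = ≤-by 0 (+-mono-≤ upper 6w≤) (solve (a ∷ b ∷ w ∷ []))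
  } , eqA , +-cancelˡ-≡ (6 * w + a) (2 * (a + b) + (2 * a + 3 * b)) B (trans eqB (sym (sum bal)))
  where
  open ≡-Reasoning
  a+b≡2w : a + b ≡ 2 * w
  a+b≡2w = +-cancelˡ-≡ (6 * w) (a + b) (2 * w) (begin
    6 * w + (a + b)   ≡⟨ +-assoc (6 * w) a b ⟨
    6 * w + a + b     ≡⟨ A+b≡8w ⟩
    2 * (2 * (2 * w)) ≡⟨ solve (w ∷ []) ⟩
    6 * w + 2 * w     ∎)
  6w≤ : 3 * (2 * w) ≤ 3 * (a + b)
  6w≤ = *-monoʳ-≤ 3 (≤-reflexive (sym a+b≡2w))
  eqA : 2 * a + (2 * a + 3 * b) ≡ 6 * w + a
  eqA = begin
    2 * a + (2 * a + 3 * b) ≡⟨ solve (a ∷ b ∷ []) ⟩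
    3 * (a + b) + a         ≡⟨ cong (λ x → 3 * x + a) a+b≡2w ⟩
    3 * (2 * w) + a         ≡⟨ solve (a ∷ w ∷ []) ⟩
    6 * w + a               ∎
  eqB : 6 * w + a + (2 * (a + b) + (2 * a + 3 * b)) ≡ 2 * (2 * (2 * (2 * w)))
  eqB = begin
    6 * w + a + (2 * (a + b) + (2 * a + 3 * b)) ≡⟨ solve (a ∷ b ∷ w ∷ []) ⟩
    6 * w + 5 * (a + b)                         ≡⟨ cong (λ x → 6 * w + 5 * x) a+b≡2w ⟩
    6 * w + 5 * (2 * w)                         ≡⟨ solve (w ∷ []) ⟩
    2 * (2 * (2 * (2 * w)))                     ∎

-- The smaller pair has half-sum 2w, so 6w is removed from each side, and 4w ≤ 3a amounts to 22w ≤
-- 3A.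
split-Pad4 : ∀ {w A B} → ∃[ a ] 6 * w + a ≡ A → ∃[ b ] 6 * w + b ≡ B →
             Balanced (2 * (2 * (2 * w))) A B → 22 * w ≤ 3 * A → 22 * w ≤ 3 * B →
             ∃₂ λ a b → Balanced (2 * w) a b × 1 * a + 3 * (2 * w) ≡ A × 1 * b + 3 * (2 * w) ≡ B
split-Pad4 {w} (a , refl) (b , refl) bal lowerA lowerB = a , b , record
  { sum  = +-cancelˡ-≡ (12 * w) (a + b) (2 * (2 * w)) (begin
      12 * w + (a + b)            ≡⟨ solve (a ∷ b ∷ w ∷ []) ⟩
      6 * w + a + (6 * w + b)     ≡⟨ sum bal ⟩
      2 * (2 * (2 * (2 * w)))     ≡⟨ solve (w ∷ []) ⟩
      12 * w + 2 * (2 * w)        ∎)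
  ; oddˡ = λ 2∣a → oddˡ bal (∣m∣n⇒∣m+n 2∣6w 2∣a)
  ; oddʳ = λ 2∣b → oddʳ bal (∣m∣n⇒∣m+n 2∣6w 2∣b)
  ; lowˡ = ≤-by 0 lowerA (solve (a ∷ w ∷ []))
  ; lowʳ = ≤-by 0 lowerB (solve (b ∷ w ∷ []))
  } , solve (a ∷ w ∷ []) , solve (b ∷ w ∷ [])
  where
  open ≡-Reasoning
  2∣6w : 2 ∣ 6 * w
  2∣6w = ∣m⇒∣m*n w (divides 3 refl)

-- The gadget that comes last in the construction of a pair. As the sides are indices, matching on a
-- view rewrites them in terms of the smaller pair.
data View : ℕ → ℕ → ℕ → Set where
  unit   : View 0 1 1
  step4  : ∀ {k A B} → Balanced (2 ^ k) A B → View (2 + k) (2 * A + B) (2 * B + (2 * A + B))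
  step4ᵀ : ∀ {k A B} → Balanced (2 ^ k) A B → View (2 + k) (2 * B + (2 * A + B)) (2 * A + B)
  step8  : ∀ {k A B} → Balanced (2 ^ k) A B → View (3 + k) (2 * A + (2 * A + 3 * B)) (2 * (A + B) + (2 * A + 3 * B))
  step8ᵀ : ∀ {k A B} → Balanced (2 ^ k) A B → View (3 + k) (2 * (A + B) + (2 * A + 3 * B)) (2 * A + (2 * A + 3 * B))
  pad4   : ∀ {k A B} → Balanced (2 ^ (1 + k)) A B → View (3 + k) (1 * A + 3 * 2 ^ (1 + k)) (1 * B + 3 * 2 ^ (1 + k))

toStep4 : ∀ {k A B} → ∃₂ (λ a b → Balanced (2 ^ k) a b × 2 * a + b ≡ A × 2 * b + (2 * a + b) ≡ B) → View (2 + k) A B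
toStep4 (_ , _ , bal , refl , refl) = step4 bal

toStep8 : ∀ {k A B} →
          ∃₂ (λ a b → Balanced (2 ^ k) a b × 2 * a + (2 * a + 3 * b) ≡ A × 2 * (a + b) + (2 * a + 3 * b) ≡ B) →
          View (3 + k) A B
toStep8 (_ , _ , bal , refl , refl) = step8 bal

toPad4 : ∀ {k A B} →
         ∃₂ (λ a b → Balanced (2 ^ (1 + k)) a b × 1 * a + 3 * 2 ^ (1 + k) ≡ A × 1 * b + 3 * 2 ^ (1 + k) ≡ B) →
         View (3 + k) A B
toPad4 (_ , _ , bal , refl , refl) = pad4 bal

view₀ : ∀ {A B} → Balanced 1 A B → A ≤ 1 → View 0 A B
view₀ {0} bal _ = contradiction (2 ∣0) (oddˡ bal)
view₀ {1} bal _ with refl ← suc-injective (sum bal) = unit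
view₀ {2+ _} bal (s≤s ())

-- The smaller side would lie between 4/3 and 2, so it would be the even number 2.
¬balanced₂ : ∀ {A B} → Balanced 2 A B → A ≤ B → ⊥
¬balanced₂ {A} bal A≤B = impossible A (oddˡ bal) (lowˡ bal) (half-≤ 2 (sum bal) A≤B)
  where
  impossible : ∀ A → ¬ (2 ∣ A) → 4 ≤ 3 * A → A ≤ 2 → ⊥
  impossible 1 _ (s≤s (s≤s (s≤s ()))) _
  impossible 2 odd _ _ = odd ∣-refl
  impossible (suc (2+ _)) _ _ (s≤s (s≤s ()))

-- The smaller side would lie between 10/3 and 4, so it would be the even number 4.
¬balanced₄ : ∀ {A B} → Balanced 4 A B → A ≤ B → 10 ≤ 3 * A → ⊥
¬balanced₄ {A} bal A≤B lower = impossible A (oddˡ bal) lower (half-≤ 4 (sum bal) A≤B)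
  where
  impossible : ∀ A → ¬ (2 ∣ A) → 10 ≤ 3 * A → A ≤ 4 → ⊥
  impossible 1 _ (s≤s (s≤s (s≤s ()))) _
  impossible 2 _ (s≤s (s≤s (s≤s (s≤s (s≤s (s≤s ())))))) _
  impossible 3 _ (s≤s (s≤s (s≤s (s≤s (s≤s (s≤s (s≤s (s≤s (s≤s ()))))))))) _
  impossible 4 odd _ _ = odd (divides 2 refl)
  impossible (suc (suc (suc (2+ _)))) _ _ (s≤s (s≤s (s≤s (s≤s ()))))

-- With A + B = 8w and A ≤ B, the gadgets reach A/w in [8/3, 10/3] (Step4),
-- [10/3, 11/3] (Step8) and [11/3, 4] (Pad4).
view-≤ : ∀ k {A B} → Balanced (2 ^ k) A B → A ≤ B → View k A B
view-≤ 0 bal A≤B = view₀ bal (half-≤ 1 (sum bal) A≤B)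
view-≤ 1 bal A≤B = ⊥-elim (¬balanced₂ bal A≤B)
view-≤ (2+ k) {A} {B} bal A≤B = [ narrow , wide k bal ]′ (≤-total (3 * A) (10 * 2 ^ k))
  where
  narrow : 3 * A ≤ 10 * 2 ^ k → View (2 + k) A B
  narrow upper = toStep4 (split-Step4 {2 ^ k}
    (m≤n⇒∃[o]m+o≡n (3*-cancel-≤ (low₂ (2 ^ k) (lowˡ bal))))
    (m≤n⇒∃[o]m+o≡n (half-≤ (2 ^ (2 + k)) (sum bal) A≤B)) bal upper)
    where
    low₂ : ∀ w {n} → 2 * (2 * (2 * w)) ≤ n → 3 * (2 * w) ≤ n
    low₂ w {n} = ≤-trans (≤-by (2 * w) (z≤n {0}) (solve (w ∷ [])))

  wide : ∀ k → Balanced (2 ^ (2 + k)) A B → 10 * 2 ^ k ≤ 3 * A → View (2 + k) A B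
  wide zero    bal lower = ⊥-elim (¬balanced₄ bal A≤B lower)
  wide (suc k) bal lower = [ middle , top ]′ (≤-total (3 * A) (22 * w))
    where
    -- Here A + B = 16w: the unit is halved, so the thresholds 10/3 and 11/3 become 20/3 and 22/3.
    w = 2 ^ k
    20w≤3A : 20 * w ≤ 3 * A
    20w≤3A = ≤-trans (≤-reflexive (*-assoc 10 2 w)) lower
    6w≤A : 6 * w ≤ A
    6w≤A = 3*-cancel-≤ (≤-trans (≤-reflexive (sym (*-assoc 3 6 w))) (≤-trans (*-monoˡ-≤ w (m≤m+n 18 2)) 20w≤3A))

    middle : 3 * A ≤ 22 * w → View (3 + k) A B
    middle upper = toStep8 (split-Step8 {w} (m≤n⇒∃[o]m+o≡n 6w≤A)
      (m≤n⇒∃[o]m+o≡n (half-≤ (2 ^ (3 + k)) (sum bal) A≤B)) bal 20w≤3A upper)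

    top : 22 * w ≤ 3 * A → View (3 + k) A B
    top lowerA = toPad4 (split-Pad4 {w} (m≤n⇒∃[o]m+o≡n 6w≤A)
      (m≤n⇒∃[o]m+o≡n (≤-trans 6w≤A A≤B)) bal lowerA (≤-trans lowerA (*-monoʳ-≤ 3 A≤B)))

view-sym : ∀ {k A B} → View k A B → View k B A
view-sym unit       = unit
view-sym (step4 b)  = step4ᵀ b
view-sym (step4ᵀ b) = step4 b
view-sym (step8 b)  = step8ᵀ b
view-sym (step8ᵀ b) = step8 b
view-sym (pad4 b)   = pad4 (Balanced-sym b)

view : ∀ k {A B} → Balanced (2 ^ k) A B → View k A B
view k {A} {B} bal = [ view-≤ k bal , (λ B≤A → view-sym (view-≤ k (Balanced-sym bal) B≤A)) ]′ (≤-total A B)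

-- Webs for all balanced pairs, and their closure.

-- A gadget that raises k by j adds at most 2j vertices, with equality for `Pad4`.
Net : ℕ → ℕ → ℕ → Set
Net k A B = Web (straight A B) (Inside A B) (2 * k + 1)

unitNet : Net 0 1 1
unitNet = record
  { cells    = cell 2 1 0 ∷ []
  ; midpoint = refl ∷ᵃ []ᵃ
  ; strandˡ  = strand (#0 ∷ᵃ []ᵃ) #0
  ; strandʳ  = strand (#0 ∷ᵃ []ᵃ) #0
  ; range    = (s≤s z≤n , s≤s (s≤s z≤n) , s≤s (s≤s z≤n)) ∷ᵃ []ᵃ
  ; unique   = []ᵃ AllPairs.∷ AllPairs.[]
  ; size     = ≤-refl
  }

module _ {w A B} (bal : Balanced w A B) where
  0<ˡ : 0 < A
  0<ˡ = odd⇒positive (oddˡ bal)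
  0<ʳ : 0 < B
  0<ʳ = odd⇒positive (oddʳ bal)

size-Step4 : ∀ k → 3 + (2 * k + 1) ≤ 2 * (2 + k) + 1
size-Step4 k = ≤-by 1 (z≤n {0}) (solve (k ∷ []))

size-Cap3 : ∀ k → 2 + (2 * k + 1) ≤ 2 * (2 + k) + 1
size-Cap3 k = ≤-by 2 (z≤n {0}) (solve (k ∷ []))

size-Step8 : ∀ k → 4 + (2 * k + 1) ≤ 2 * (3 + k) + 1
size-Step8 k = ≤-by 2 (z≤n {0}) (solve (k ∷ []))

size-Pad4 : ∀ k → 4 + (2 * (1 + k) + 1) ≤ 2 * (3 + k) + 1
size-Pad4 k = ≤-by 0 (z≤n {0}) (solve (k ∷ []))

net : ∀ k {A B} → Balanced (2 ^ k) A B → Net k A B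
net = <-rec (λ k → ∀ {A B} → Balanced (2 ^ k) A B → Net k A B) λ k rec bal → build rec (view k bal)
  where
  build : ∀ {k A B} → (∀ {j} → j < k → ∀ {A B} → Balanced (2 ^ j) A B → Net j A B) → View k A B → Net k A B
  build rec unit           = unitNet
  build rec (step4 {k} b)  = weaken id (size-Step4 k) (Step4.grow _ _ (0<ˡ b) (0<ʳ b) (oddʳ b) (rec (m<n+m k z<s) b))
  build rec (step4ᵀ {k} b) = weaken id (size-Step4 k) (Step4.growᵀ _ _ (0<ˡ b) (0<ʳ b) (oddʳ b) (rec (m<n+m k z<s) b))
  build rec (step8 {k} b)  = weaken id (size-Step8 k) (Step8.grow _ _ (0<ˡ b) (0<ʳ b) (rec (m<n+m k z<s) b))
  build rec (step8ᵀ {k} b) = weaken id (size-Step8 k) (Step8.growᵀ _ _ (0<ˡ b) (0<ʳ b) (rec (m<n+m k z<s) b))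
  build rec (pad4 {k} b)   = weaken id (size-Pad4 k) (Pad4.grow _ _ _ (0<ˡ b) (0<ʳ b) (m^n>0 2 (1 + k)) (sum b) (rec (m<n+m (1 + k) {2} z<s) b))

-- `Inside` does not by itself make vertices distinct modulo the side. So the net is built only up
-- to the last gadget, whose own closing lemma proves this. The pair (1 , 1) is excluded because its
-- only cell does not move modulo 1.
closeUpBalanced : ∀ k {A p} .{{_ : NonZero p}} → Balanced (2 ^ k) A p → p ≢ 1 → Closed p (2 * k + 1)
closeUpBalanced k bal p≢1 = closeView (view k bal) p≢1
  where
  enlarge : ∀ {p n n′} → n ≤ n′ → Closed p n → Closed p n′
  enlarge n≤n′ (cs , conf , short) = cs , conf , ≤-trans short n≤n′

  closeView : ∀ {k A p} .{{_ : NonZero p}} → View k A p → p ≢ 1 → Closed p (2 * k + 1)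
  closeView unit       1≢1 = contradiction refl 1≢1
  closeView (step4 {k} b)  _ = enlarge (size-Step4 k) (Step4.close _ _ (0<ˡ b) (0<ʳ b) (oddʳ b) (net k b))
  closeView (step4ᵀ {k} {A} {B} b) _ = subst (λ p → Closed p (2 * (2 + k) + 1)) eq
    (enlarge (size-Cap3 k) (Cap3.close A B (0<ˡ b) (0<ʳ b) {{>-nonZero 0<p}} (net k b)))
    where
    0<p : 0 < 1 * A + (A + B)
    0<p = <-≤-trans (0<ˡ b) (≤-trans (m≤m+n A 0) (m≤m+n (1 * A) (A + B)))
    eq : 1 * A + (A + B) ≡ 2 * A + B
    eq = solve (A ∷ B ∷ [])
  closeView (step8 {k} b)  _ = enlarge (size-Step8 k) (Step8.close _ _ (0<ˡ b) (0<ʳ b) (net k b))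
  closeView (step8ᵀ {k} b) _ = enlarge (size-Step8 k) (Step8.closeᵀ _ _ (0<ˡ b) (0<ʳ b) (oddʳ b) (net k b))
  closeView (pad4 {k} b)  _ = enlarge (size-Pad4 k) (Pad4.close _ _ _ (0<ˡ b) (0<ʳ b) (m^n>0 2 (1 + k)) (sum b) (m∣m*n (2 ^ k)) (oddʳ b) (net (1 + k) b))

-- The choice of the power of two, halving in ℤ_p, and the theorem.

scale : ∀ n → 2 ≤ n → ∃[ k ] 2 * 2 ^ k ≤ n × n < 2 * (2 * 2 ^ k)
scale 1 (s≤s ())
scale 2 _ = 0 , ≤-refl , s≤s (s≤s (s≤s z≤n))
scale (suc (2+ n)) _ with k , lower , upper ← scale (2+ n) (s≤s (s≤s z≤n)) with m≤n⇒m<n∨m≡n upper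
... | inj₁ below = k , m≤n⇒m≤1+n lower , below
... | inj₂ eq    = suc k , ≤-reflexive (sym eq) , ≤-<-trans (≤-reflexive eq)
  (m<m+n (2 ^ (2 + k)) (≤-trans (m^n>0 2 (2 + k)) (m≤m+n (2 ^ (2 + k)) 0)))

-- The partner is A = 2w - p, and 3A = 6w - 3p ≥ 2w because 3p ≤ 4w.
balance : ∀ {p w} → ¬ (2 ∣ p) → 2 * w ≤ 3 * p → 3 * p ≤ 2 * (2 * w) → ∃[ A ] p + A ≡ 2 * w → ∃[ A ] Balanced w A p
balance {p} {w} odd lower upper (A , p+A≡2w) = A , record
  { sum  = trans (+-comm A p) p+A≡2w
  ; oddˡ = λ 2∣A → odd (∣m+n∣m⇒∣n (subst (2 ∣_) (trans (sym p+A≡2w) (+-comm p A)) (m∣m*n w)) 2∣A)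
  ; oddʳ = odd
  ; lowˡ = ≤-by 0 (+-mono-≤ upper 6w≤) (solve (A ∷ p ∷ w ∷ []))
  ; lowʳ = lower
  }
  where
  6w≤ : 3 * (2 * w) ≤ 3 * (p + A)
  6w≤ = *-monoʳ-≤ 3 (≤-reflexive (sym p+A≡2w))

-- Multiplication by (p + 1) / 2, which is `suc q`, halves modulo p: twice x is s + s p.
double-surjective : ∀ {p} → ¬ (2 ∣ p) → ∀ (s : Fin p) → ∃[ x ] x ⊕ x ≡ s
double-surjective {p@(suc _)} odd s = reduce p x , toℕ-injective (begin
  toℕ (reduce p x ⊕ reduce p x) ≡⟨ cong toℕ (reduce-⊕ p x x) ⟩
  toℕ (reduce p (x + x))        ≡⟨ toℕ-reduce p (x + x) ⟩
  (x + x) % p                   ≡⟨ cong (_% p) x+x≡s+s*p ⟩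
  (toℕ s + toℕ s * p) % p       ≡⟨ [m+kn]%n≡m%n (toℕ s) (toℕ s) p ⟩
  toℕ s % p                     ≡⟨ m<n⇒m%n≡m (toℕ<n s) ⟩
  toℕ s                         ∎)
  where
  open ≡-Reasoning
  q x : ℕ
  q = p / 2
  x = toℕ s * suc q

  p%2≡1 : p % 2 ≡ 1
  p%2≡1 with p % 2 in eq | m%n<n p 2
  ... | 0 | _ = contradiction (m%n≡0⇒n∣m p 2 eq) odd
  ... | 1 | _ = refl
  ... | 2+ _ | s≤s (s≤s ())

  double : ∀ m n → m * suc n + m * suc n ≡ m + m * (1 + n * 2)
  double m n = solve (m ∷ n ∷ [])

  x+x≡s+s*p : x + x ≡ toℕ s + toℕ s * p
  x+x≡s+s*p = trans (double (toℕ s) q)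
    (cong (λ n → toℕ s + toℕ s * n) (sym (trans (m≡m%n+[m/n]*n p 2) (cong (_+ q * 2) p%2≡1))))

NearDiagonal : ℕ → ℕ → Set
NearDiagonal p n = Σ[ T ∈ List (Triple p) ] IsTransversal (B p) T × ¬ (T ∼[ set ] mainDiagonal p) × length (offDiagonal T) ≤ n

theorem6p3 : Σ[ C ∈ ℕ ] 0 < C × (∀ (p : ℕ) → Prime p → ¬ (2 ∣ p) → Σ[ T ∈ List (Triple p) ] IsTransversal (B p) T × ¬ (T ∼[ set ] mainDiagonal p) × length (offDiagonal T) ≤ C * ⌊log₂ p ⌋)
-- With l = ⌊log₂ p⌋ ≥ 1 and k ≤ l + 1, the size 2k + 1 is at most 2l + 3 ≤ 5l.
theorem6p3 = 5 , z<s , construct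
  where
  module _ (p : ℕ) (prime : Prime p) (odd : ¬ (2 ∣ p)) where
    private instance
      p≢0 : NonZero p
      p≢0 = prime⇒nonZero prime

    halves : ∀ s → ∃[ x ] x ⊕ x ≡ s
    halves = double-surjective odd

    length-≤ : ∀ k → 2 * 2 ^ k ≤ 3 * p → 2 * k + 1 ≤ 5 * ⌊log₂ p ⌋
    length-≤ k lower = begin
      2 * k + 1               ≤⟨ +-monoˡ-≤ 1 (*-monoʳ-≤ 2 k≤1+log) ⟩
      2 * suc ⌊log₂ p ⌋ + 1   ≤⟨ absorb ⌊log₂ p ⌋ (⌊log₂⌋-mono-≤ (nonTrivial⇒n>1 p {{prime⇒nonTrivial prime}})) ⟩
      5 * ⌊log₂ p ⌋           ∎
      where
      open ≤-Reasoning
      -- From 2 · 2^k ≤ 3p ≤ 4p follows 2^k ≤ 2p.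
      k≤1+log : k ≤ suc ⌊log₂ p ⌋
      k≤1+log = begin
        k                 ≡⟨ ⌊log₂[2^n]⌋≡n k ⟨
        ⌊log₂ 2 ^ k ⌋     ≤⟨ ⌊log₂⌋-mono-≤ {2 ^ k} {2 * p} (*-cancelˡ-≤ 2 (≤-trans lower (≤-trans (*-monoˡ-≤ p (m≤m+n 3 1)) (≤-reflexive (*-assoc 2 2 p))))) ⟩
        ⌊log₂ 2 * p ⌋     ≡⟨ ⌊log₂[2*b]⌋≡1+⌊log₂b⌋ p ⟩
        suc ⌊log₂ p ⌋     ∎

      absorb : ∀ l → 1 ≤ l → 2 * suc l + 1 ≤ 5 * l
      absorb l 1≤l = ≤-by 0 (+-mono-≤ 1≤l (+-mono-≤ 1≤l 1≤l)) (solve (l ∷ []))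

    configuration : ∀ k → 2 * 2 ^ k ≤ 3 * p → 3 * p ≤ 2 * (2 * 2 ^ k) → Closed p (2 * k + 1)
    configuration k lower upper = closeUpBalanced k
      (proj₂ (balance odd lower upper (m≤n⇒∃[o]m+o≡n (*-cancelˡ-≤ 2 (≤-trans (*-monoˡ-≤ p (m≤m+n 2 1)) upper)))))
      (nonTrivial⇒≢1 {{prime⇒nonTrivial prime}})

    fromConfiguration : ∀ {n} → n ≤ 5 * ⌊log₂ p ⌋ → Closed p n → NearDiagonal p (5 * ⌊log₂ p ⌋)
    fromConfiguration n≤ (cs , conf , short) =
      transversal halves conf , isTransversal halves conf , notDiagonal halves conf ,
      ≤-trans (offDiagonal-≤ halves conf) (≤-trans short n≤)

    fromScale : ∃[ k ] 2 * 2 ^ k ≤ 3 * p × 3 * p < 2 * (2 * 2 ^ k) → NearDiagonal p (5 * ⌊log₂ p ⌋)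
    fromScale (k , lower , upper) = fromConfiguration (length-≤ k lower) (configuration k lower (<⇒≤ upper))

    construct : NearDiagonal p (5 * ⌊log₂ p ⌋)
    -- Scaling 3p rather than p gives 2w ≤ 3p < 4w for w = 2^k, the range that `balance` asks for.
    construct = fromScale (scale (3 * p) (≤-trans (s≤s (s≤s z≤n)) (*-monoʳ-≤ 3 (odd⇒positive odd))))
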